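{- The fertility map $\Phi\colon\mathcal{A}T\to\mathcal{A}M_{ -1}$ is a morphism of pre-Lie-Rinehart algebras: its restriction $\Phi\colon\mathcal A\to S(M_0)$ is a unital algebra morphism, and for all $X,Y\in\mathcal{A}T$ and $\mathbf a\in\mathcal A$ one has $\Phi(X\curvearrowright Y)=\Phi(X)\rhd\Phi(Y)$, $\Phi(\mathbf aX)=\Phi(\mathbf a)\odot\Phi(X)$, and $\Phi(\rho(X)\mathbf a)=\rho(\Phi(X))(\Phi(\mathbf a))$.
   Context: Fix a field $\mathbb K$ and a finite set $C$ of decorations. Trees side. An aromatic tree is a finite directed graph $(V,E)$ whose vertices carry decorations $d(v)\in C$, in which every vertex has exactly one outgoing edge except one vertex, the root, which has none; it is considered up to decoration-preserving isomorphism. The connected component of the root is a (rooted) tree; the other components are aromas (connected graphs in which every vertex has exactly one outgoing edge; each contains exactly one directed cycle). Let $T$ be the span of trees, $A_0$ the span of aromas, $\mathcal A=S(A_0)$ the symmetric algebra (multiaromas, product written by juxtaposition), and $\mathcal AT=\mathcal A\otimes T$ the span of aromatic trees $\mathbf a\tau$. The fertility $f(v)$ of a vertex is the number of edges ending at $v$. Grafting: for a tree $\tau_1$ and a tree or aroma $x$, $\tau_1\curvearrowright x$ is the sum over vertices $v$ of $x$ of the graph obtained by adding an edge from the root of $\tau_1$ to $v$; on multiaromas $\tau\curvearrowright(a^1\cdots a^m)=\sum_i a^1\cdots(\tau\curvearrowright a^i)\cdots a^m$; on aromatic trees $(\mathbf a_1\tau_1)\curvearrowright(\mathbf a_2\tau_2)=\mathbf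 a_1\mathbf a_2(\tau_1\curvearrowright\tau_2)+\mathbf a_1(\tau_1\curvearrowright\mathbf a_2)\tau_2$. The anchor is $\rho(\mathbf a_1\tau_1)(\mathbf a)=\mathbf a_1(\tau_1\curvearrowright\mathbf a)$. (With these, $\mathcal AT$ is a pre-Lie-Rinehart algebra over $\mathcal A$.) Multi-index side. $\overline N(C)$ is the polynomial algebra over $\mathbb K$ in variables $x^a_j$, $a\in C$, $j\ge -1$; monomials $x^{\mathbf k}=\prod(x^a_j)^{k^a_j}$ have weight $\sum j k^a_j$; $\partial$ is the derivation with $\partial x^a_j=x^a_{j+1}$; $M_n$ is the span of monomials of weight $n$ ($n=-1,0$; non-constant for $n=0$). $S(V)$ is the symmetric algebra with product $\odot$; $\mathcal AM_{ -1}=S(M_0)\otimes M_{ -1}$. The product $\rhd$: for monomials $x^{\mathbf k}\in M_{ -1}$ and $P\in M_0\cup M_{ -1}$, $x^{\mathbf k}\rhd P=x^{\mathbf k}\partial P$; $x^{\mathbf k}\rhd(x^{\kappa^1}\odot\cdots\odot x^{\kappa^m})=\sum_i x^{\kappa^1}\odot\cdots\odot(x^{\mathbf k}\rhd x^{\kappa^i})\odot\cdots\odot x^{\kappa^m}$; $(\mathbf y^1\odot x^{\mathbf k})\rhd\mathbf y=\mathbf y^1\odot(x^{\mathbf k}\rhd\mathbf y)$; $(\mathbf y^1\odot x^{\mathbf k^1})\rhd(\mathbf y^2\odot x^{\mathbf k^2})=\mathbf y^1\odot(x^{\mathbf k^1}\rhd\mathbf y^2)\odot x^{\mathbf k^2}+\mathbf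 y^1\odot\mathbf y^2\odot(x^{\mathbf k^1}\rhd x^{\mathbf k^2})$. The anchor is $\rho(X)(\mathbf y)=X\rhd\mathbf y$. Fertility map: for a tree $t$, $\Phi(t)=\prod_{v}x^{d(v)}_{f(v)-1}\in M_{ -1}$; for an aroma $a$, $\Phi(a)=\prod_v x^{d(v)}_{f(v)-1}\in M_0$; $\Phi(a^1\cdots a^nt)=\Phi(a^1)\odot\cdots\odot\Phi(a^n)\odot\Phi(t)$, extended linearly. -}

module Defs where

open import Level using (Level; _⊔_; 0ℓ) renaming (suc to lsuc)
open import Algebra.Bundles using (CommutativeRing; CommutativeMonoid)
open import Algebra.Module.Bundles using (Module)
open import Algebra.Structures using (IsCommutativeRing)
open import Algebra.Module.Structures using (IsModule)
open import Algebra.Module.Structures.Biased using (IsModuleFromLeft)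
import Algebra.Module.Morphism.Structures as ModuleMorphism
import Algebra.Properties.AbelianGroup as AbelianGroupProperties
import Algebra.Properties.CommutativeSemigroup as CommutativeSemigroupProperties
import Algebra.Properties.CommutativeMonoid.Sum as Summation
open import Data.Bool.Base using (Bool; true; false; if_then_else_; _∧_)
open import Data.Fin.Base using (Fin; zero; suc; splitAt; join; _↑ˡ_; _↑ʳ_)
open import Data.Fin.Properties using (_≟_; splitAt-join; join-splitAt; splitAt-↑ˡ; splitAt-↑ʳ; +↔⊎)
open import Data.Fin.Permutation using (Permutation; _⟨$⟩ʳ_; _⟨$⟩ˡ_; inverseʳ; inverseˡ; _∘ₚ_; flip)
import Data.Fin.Permutation as Perm
open import Data.Integer.Base as ℤ using (ℤ; 0ℤ; 1ℤ; -1ℤ)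
import Data.Integer.Properties as ℤₚ
open import Data.List.Base using (List; []; _∷_; foldr; tabulate; _++_)
open import Data.Nat.Base as ℕ using (ℕ; zero; suc; NonZero)
import Data.Nat.Properties as ℕₚ
open import Data.Product.Base using (Σ; ∃; _×_; _,_; proj₁; proj₂)
open import Data.Sum.Base as Sum using (_⊎_; inj₁; inj₂; [_,_])
open import Data.Sum.Function.Propositional using (_⊎-↔_)
open import Function.Base using (_∘_)
open import Function.Bundles using (_↔_)
open import Function.Construct.Composition using (_↔-∘_)
open import Function.Construct.Symmetry using (↔-sym)
open import Relation.Binary.Bundles using (Setoid)
open import Relation.Binary.Structures using (IsEquivalence)
open import Relation.Binary.Construct.Closure.Equivalence using (EqClosure; gmap; transitive; symmetric)
open import Relation.Binary.Construct.Closure.ReflexiveTransitive using (ε; _◅_)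
open import Relation.Binary.Construct.Closure.Symmetric using (fwd)
import Relation.Binary.Reasoning.Setoid as SetoidReasoning
open import Relation.Binary.PropositionalEquality as ≡ using (_≡_; _≢_; refl; cong; cong₂)
open import Relation.Nullary using (¬_; does; yes; no; contradiction)
open import Relation.Nullary.Decidable using (dec-true; dec-false)

record Field (c ℓ : Level) : Set (lsuc (c ⊔ ℓ)) where
  field
    commutativeRing : CommutativeRing c ℓ
  open CommutativeRing commutativeRing public
  field
    1≉0     : ¬ (1# ≈ 0#)
    inverse : ∀ x → ¬ (x ≈ 0#) → ∃ λ y → x * y ≈ 1#

module ℕ∑ = Summation ℕₚ.+-0-commutativeMonoid

module _ {a ℓ : Level} (M : CommutativeMonoid a ℓ) where
  open CommutativeMonoid M
  private
    module ∑ = Summation M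

  sum-⊎ : ∀ m {n} (f : Fin m ⊎ Fin n → Carrier) →
          ∑.sum (λ i → f (splitAt m i)) ≈ ∑.sum (f ∘ inj₁) ∙ ∑.sum (f ∘ inj₂)
  sum-⊎ zero    f = sym (identityˡ _)
  sum-⊎ (suc m) f = trans (∙-congˡ (sum-⊎ m (f ∘ Sum.map₁ suc))) (sym (assoc _ _ _))

indicator : Bool → ℕ
indicator b = if b then 1 else 0

count : ∀ {n} → (Fin n → Bool) → ℕ
count p = ℕ∑.sum (λ i → indicator (p i))

count-false : ∀ n → count {n} (λ _ → false) ≡ 0
count-false n = ℕ∑.sum-replicate-zero n

count-≟ : ∀ {n} (v : Fin n) → count (λ w → does (w ≟ v)) ≡ 1
count-≟ {suc n} zero    = cong suc (count-false n)
count-≟ {suc n} (suc v) = count-≟ v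

-- Loops are allowed. Parallel edges need not be: every vertex considered
-- below has at most one outgoing edge.
record Graph (C : Set) : Set where
  field
    size : ℕ
    deco : Fin size → C
    edge : Fin size → Fin size → Bool

  outdegree fertility : Fin size → ℕ
  outdegree v = count (λ w → edge v w)
  fertility v = count (λ u → edge u v)

  Connected : Set
  Connected = ∀ v w → EqClosure (λ x y → edge x y ≡ true) v w

record _≅_ {C : Set} (G H : Graph C) : Set where
  private
    module G = Graph G
    module H = Graph H
  field
    bij       : Permutation G.size H.size
    deco-pres : ∀ v → H.deco (bij ⟨$⟩ʳ v) ≡ G.deco v
    edge-pres : ∀ v w → H.edge (bij ⟨$⟩ʳ v) (bij ⟨$⟩ʳ w) ≡ G.edge v w

  outdegree-pres : ∀ v → H.outdegree (bij ⟨$⟩ʳ v) ≡ G.outdegree v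
  outdegree-pres v = ≡.trans (ℕ∑.sum-permute _ bij)
                             (ℕ∑.sum-cong-≗ (λ w → cong indicator (edge-pres v w)))

  fertility-pres : ∀ v → H.fertility (bij ⟨$⟩ʳ v) ≡ G.fertility v
  fertility-pres v = ≡.trans (ℕ∑.sum-permute _ bij)
                             (ℕ∑.sum-cong-≗ (λ u → cong indicator (edge-pres u v)))

≅-isEquivalence : ∀ {C} → IsEquivalence (_≅_ {C})
≅-isEquivalence = record
  { refl  = record { bij = Perm.id ; deco-pres = λ _ → refl ; edge-pres = λ _ _ → refl }
  ; sym   = λ {G} {H} p → let open _≅_ p in record
    { bij = flip bij
    ; deco-pres = λ v → ≡.trans (≡.sym (deco-pres _)) (cong (Graph.deco H) (inverseʳ bij))
    ; edge-pres = λ v w → ≡.trans (≡.sym (edge-pres _ _))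
                                  (cong₂ (Graph.edge H) (inverseʳ bij) (inverseʳ bij))
    }
  ; trans = λ p q → record
    { bij = _≅_.bij p ∘ₚ _≅_.bij q
    ; deco-pres = λ v → ≡.trans (_≅_.deco-pres q _) (_≅_.deco-pres p v)
    ; edge-pres = λ v w → ≡.trans (_≅_.edge-pres q _ _) (_≅_.edge-pres p v w)
    }
  }

record Tree (C : Set) : Set where
  field
    graph : Graph C
  open Graph graph public
  field
    root          : Fin size
    root-out      : outdegree root ≡ 0
    nonroot-out   : ∀ v → v ≢ root → outdegree v ≡ 1
    connected     : Connected

record Aroma (C : Set) : Set where
  field
    graph : Graph C
  open Graph graph public
  field
    nonempty  : NonZero size
    out       : ∀ v → outdegree v ≡ 1
    connected : Connected

TreeSetoid : Set → Setoid 0ℓ 0ℓ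
TreeSetoid C = record
  { Carrier = Tree C ; _≈_ = λ s t → Tree.graph s ≅ Tree.graph t
  ; isEquivalence = record { refl = E.refl ; sym = E.sym ; trans = E.trans } }
  where module E = IsEquivalence (≅-isEquivalence {C})

AromaSetoid : Set → Setoid 0ℓ 0ℓ
AromaSetoid C = record
  { Carrier = Aroma C ; _≈_ = λ s t → Aroma.graph s ≅ Aroma.graph t
  ; isEquivalence = record { refl = E.refl ; sym = E.sym ; trans = E.trans } }
  where module E = IsEquivalence (≅-isEquivalence {C})

-- The disjoint union of τ and x together with an edge from r to v.
module _ {C : Set} (τ : Graph C) (r : Fin (Graph.size τ)) (x : Graph C) (v : Fin (Graph.size x)) where
  private
    module τ = Graph τ
    module x = Graph x

  graftEdge : Fin τ.size ⊎ Fin x.size → Fin τ.size ⊎ Fin x.size → Bool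
  graftEdge (inj₁ u) (inj₁ u′) = τ.edge u u′
  graftEdge (inj₁ u) (inj₂ w)  = does (u ≟ r) ∧ does (w ≟ v)
  graftEdge (inj₂ w) (inj₁ u)  = false
  graftEdge (inj₂ w) (inj₂ w′) = x.edge w w′

  graftGraph : Graph C
  graftGraph = record
    { size = τ.size ℕ.+ x.size
    ; deco = λ a → [ τ.deco , x.deco ] (splitAt τ.size a)
    ; edge = λ a b → graftEdge (splitAt τ.size a) (splitAt τ.size b)
    }

  private
    module G = Graph graftGraph

    outdeg′ : Fin τ.size ⊎ Fin x.size → ℕ
    outdeg′ s = count (λ u → graftEdge s (inj₁ u)) ℕ.+ count (λ w → graftEdge s (inj₂ w))

    outdeg-split : ∀ a → G.outdegree a ≡ outdeg′ (splitAt τ.size a)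
    outdeg-split a = sum-⊎ ℕₚ.+-0-commutativeMonoid τ.size
      (λ s → indicator (graftEdge (splitAt τ.size a) s))

    outdeg′-inj₂ : ∀ w → outdeg′ (inj₂ w) ≡ x.outdegree w
    outdeg′-inj₂ w = cong (ℕ._+ x.outdegree w) (count-false τ.size)

    outdeg′-inj₁ : τ.outdegree r ≡ 0 → (∀ u → u ≢ r → τ.outdegree u ≡ 1) →
                   ∀ u → outdeg′ (inj₁ u) ≡ 1
    outdeg′-inj₁ r-out out u with u ≟ r
    ... | yes refl = cong₂ ℕ._+_ r-out (count-≟ v)
    ... | no u≢r   = cong₂ ℕ._+_ (out u u≢r) (count-false x.size)

    Path : Fin G.size → Fin G.size → Set
    Path = EqClosure (λ a b → G.edge a b ≡ true)

    pathˡ : ∀ {u u′} → EqClosure (λ a b → τ.edge a b ≡ true) u u′ →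
            Path (u ↑ˡ x.size) (u′ ↑ˡ x.size)
    pathˡ = gmap (_↑ˡ x.size) λ {a} {b} p →
      ≡.trans (cong₂ graftEdge (splitAt-↑ˡ τ.size a x.size) (splitAt-↑ˡ τ.size b x.size)) p

    pathʳ : ∀ {w w′} → EqClosure (λ a b → x.edge a b ≡ true) w w′ →
            Path (τ.size ↑ʳ w) (τ.size ↑ʳ w′)
    pathʳ = gmap (τ.size ↑ʳ_) λ {a} {b} p →
      ≡.trans (cong₂ graftEdge (splitAt-↑ʳ τ.size x.size a) (splitAt-↑ʳ τ.size x.size b)) p

    bridge : Path (r ↑ˡ x.size) (τ.size ↑ʳ v)
    bridge = fwd (≡.trans
      (cong₂ graftEdge (splitAt-↑ˡ τ.size r x.size) (splitAt-↑ʳ τ.size x.size v))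
      (cong₂ _∧_ (dec-true (r ≟ r) refl) (dec-true (v ≟ v) refl))) ◅ ε

    to-v : τ.Connected → x.Connected → ∀ s → Path (join τ.size x.size s) (τ.size ↑ʳ v)
    to-v cτ cx (inj₁ u) = transitive _ (pathˡ (cτ u r)) bridge
    to-v cτ cx (inj₂ w) = pathʳ (cx w v)

  graft-connected : τ.Connected → x.Connected → G.Connected
  graft-connected cτ cx a b = transitive _ (path a) (symmetric _ (path b))
    where
    path : ∀ a → Path a (τ.size ↑ʳ v)
    path a = ≡.subst (λ a′ → Path a′ (τ.size ↑ʳ v)) (join-splitAt τ.size x.size a)
                     (to-v cτ cx (splitAt τ.size a))

  module _ (r-out : τ.outdegree r ≡ 0) (out : ∀ u → u ≢ r → τ.outdegree u ≡ 1) where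

    graft-outʳ : ∀ w → G.outdegree (τ.size ↑ʳ w) ≡ x.outdegree w
    graft-outʳ w = ≡.trans (outdeg-split _)
      (≡.trans (cong outdeg′ (splitAt-↑ʳ τ.size x.size w)) (outdeg′-inj₂ w))

    graft-out : ∀ a → (∀ w → τ.size ↑ʳ w ≡ a → x.outdegree w ≡ 1) → G.outdegree a ≡ 1
    graft-out a p = ≡.trans (outdeg-split a)
      (go (splitAt τ.size a) (join-splitAt τ.size x.size a))
      where
      go : ∀ s → join τ.size x.size s ≡ a → outdeg′ s ≡ 1
      go (inj₁ u) _ = outdeg′-inj₁ r-out out u
      go (inj₂ w) q = ≡.trans (outdeg′-inj₂ w) (p w q)

graftTree : ∀ {C} (τ σ : Tree C) → Fin (Tree.size σ) → Tree C
graftTree τ σ v = record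
  { graph       = graftGraph τ.graph τ.root σ.graph v
  ; root        = τ.size ↑ʳ σ.root
  ; root-out    = ≡.trans (graft-outʳ τ.graph τ.root σ.graph v τ.root-out τ.nonroot-out σ.root) σ.root-out
  ; nonroot-out = λ a a≢ → graft-out τ.graph τ.root σ.graph v τ.root-out τ.nonroot-out a
      (λ w p → σ.nonroot-out w (λ q → a≢ (≡.trans (≡.sym p) (cong (τ.size ↑ʳ_) q))))
  ; connected   = graft-connected τ.graph τ.root σ.graph v τ.connected σ.connected
  }
  where
  module τ = Tree τ
  module σ = Tree σ

graftAroma : ∀ {C} (τ : Tree C) (a : Aroma C) → Fin (Aroma.size a) → Aroma C
graftAroma τ a v = record
  { graph     = graftGraph τ.graph τ.root a.graph v
  ; nonempty  = ℕ.≢-nonZero (λ p → ℕ.≢-nonZero⁻¹ a.size {{a.nonempty}} (ℕₚ.m+n≡0⇒n≡0 τ.size p))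
  ; out       = λ b → graft-out τ.graph τ.root a.graph v τ.root-out τ.nonroot-out b (λ w _ → a.out w)
  ; connected = graft-connected τ.graph τ.root a.graph v τ.connected a.connected
  }
  where
  module τ = Tree τ
  module a = Aroma a

root-pres : ∀ {C} (τ σ : Tree C) (p : Tree.graph τ ≅ Tree.graph σ) →
            _≅_.bij p ⟨$⟩ʳ Tree.root τ ≡ Tree.root σ
root-pres τ σ p with _≅_.bij p ⟨$⟩ʳ Tree.root τ ≟ Tree.root σ
... | yes q = q
... | no q  = contradiction
  (≡.trans (≡.sym (Tree.nonroot-out σ _ q)) (≡.trans (_≅_.outdegree-pres p _) (Tree.root-out τ)))
  λ ()

does-≟ : ∀ {m n} (π : Permutation m n) i j →
         does ((π ⟨$⟩ʳ i) ≟ (π ⟨$⟩ʳ j)) ≡ does (i ≟ j)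
does-≟ π i j with i ≟ j
... | yes refl = dec-true ((π ⟨$⟩ʳ i) ≟ (π ⟨$⟩ʳ i)) refl
... | no i≢j   = dec-false ((π ⟨$⟩ʳ i) ≟ (π ⟨$⟩ʳ j))
  (λ q → i≢j (≡.trans (≡.sym (inverseˡ π)) (≡.trans (cong (π ⟨$⟩ˡ_) q) (inverseˡ π))))

module _ {C : Set} {τ τ′ x x′ : Graph C} (p : τ ≅ τ′) (q : x ≅ x′) where
  private
    module τ = Graph τ
    module τ′ = Graph τ′
    module x = Graph x
    module x′ = Graph x′
    module p = _≅_ p
    module q = _≅_ q

    move : Fin τ.size ⊎ Fin x.size → Fin τ′.size ⊎ Fin x′.size
    move = Sum.map (p.bij ⟨$⟩ʳ_) (q.bij ⟨$⟩ʳ_)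

    π : Permutation (τ.size ℕ.+ x.size) (τ′.size ℕ.+ x′.size)
    π = ↔-sym +↔⊎ ↔-∘ ((p.bij ⊎-↔ q.bij) ↔-∘ +↔⊎)

    split-π : ∀ a → splitAt τ′.size (π ⟨$⟩ʳ a) ≡ move (splitAt τ.size a)
    split-π a = splitAt-join τ′.size x′.size (move (splitAt τ.size a))

  graft-cong : ∀ {r r′} → p.bij ⟨$⟩ʳ r ≡ r′ → ∀ v →
               graftGraph τ r x v ≅ graftGraph τ′ r′ x′ (q.bij ⟨$⟩ʳ v)
  graft-cong {r} refl v = record
    { bij       = π
    ; deco-pres = λ a → ≡.trans (cong [ τ′.deco , x′.deco ] (split-π a)) (deco-move (splitAt τ.size a))
    ; edge-pres = λ a b → ≡.trans (cong₂ (graftEdge τ′ _ x′ _) (split-π a) (split-π b))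
                                  (edge-move (splitAt τ.size a) (splitAt τ.size b))
    }
    where
    deco-move : ∀ s → [ τ′.deco , x′.deco ] (move s) ≡ [ τ.deco , x.deco ] s
    deco-move (inj₁ u) = p.deco-pres u
    deco-move (inj₂ w) = q.deco-pres w

    edge-move : ∀ s t → graftEdge τ′ (p.bij ⟨$⟩ʳ r) x′ (q.bij ⟨$⟩ʳ v) (move s) (move t)
                      ≡ graftEdge τ r x v s t
    edge-move (inj₁ u) (inj₁ u′) = p.edge-pres u u′
    edge-move (inj₁ u) (inj₂ w)  = cong₂ _∧_ (does-≟ p.bij u r) (does-≟ q.bij w v)
    edge-move (inj₂ w) (inj₁ u)  = refl
    edge-move (inj₂ w) (inj₂ w′) = q.edge-pres w w′

-- (a , i) stands for x^a_{i-1}: indices are shifted by one, so that a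
-- vertex of decoration a and fertility f contributes (a , f).
Var : Set → Set
Var C = C × ℕ

module _ {C : Set} where

  raise : Var C → Var C
  raise (a , i) = a , suc i

  varWeight : Var C → ℤ
  varWeight (_ , i) = ℤ.+ i ℤ.- 1ℤ

  -- A list of variables encodes the monomial that is their product.
  weight : List (Var C) → ℤ
  weight = foldr (λ v n → varWeight v ℤ.+ n) 0ℤ

  weight-++ : ∀ ks ls → weight (ks ++ ls) ≡ weight ks ℤ.+ weight ls
  weight-++ []       ls = ≡.sym (ℤₚ.+-identityˡ _)
  weight-++ (k ∷ ks) ls = ≡.trans (cong (λ n → varWeight k ℤ.+ n) (weight-++ ks ls))
                                  (≡.sym (ℤₚ.+-assoc (varWeight k) (weight ks) (weight ls)))

  varWeight-raise : ∀ v → varWeight (raise v) ≡ varWeight v ℤ.+ 1ℤ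
  varWeight-raise (_ , i) = begin
    ℤ.+ suc i ℤ.- 1ℤ             ≡⟨ cong (λ k → ℤ.+ k ℤ.- 1ℤ) (ℕₚ.+-comm 1 i) ⟩
    (ℤ.+ i ℤ.+ 1ℤ) ℤ.- 1ℤ        ≡⟨ ℤₚ.+-assoc (ℤ.+ i) 1ℤ -1ℤ ⟩
    ℤ.+ i ℤ.+ (-1ℤ ℤ.+ 1ℤ)       ≡⟨ ℤₚ.+-assoc (ℤ.+ i) -1ℤ 1ℤ ⟨
    (ℤ.+ i ℤ.- 1ℤ) ℤ.+ 1ℤ        ∎
    where open ≡.≡-Reasoning

  -- The monomial ∏_v x^{d(v)}_{f(v)-1}.
  fertilities : Graph C → List (Var C)
  fertilities G = tabulate (λ v → deco v , fertility v)
    where open Graph G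

  weight-tabulate : ∀ n (f : Fin n → Var C) →
                    weight (tabulate f) ≡ ℤ.+ ℕ∑.sum (proj₂ ∘ f) ℤ.- ℤ.+ n
  weight-tabulate zero    f = refl
  weight-tabulate (suc n) f = begin
    (ℤ.+ k ℤ.- 1ℤ) ℤ.+ weight (tabulate (f ∘ suc)) ≡⟨ cong (λ w → (ℤ.+ k ℤ.- 1ℤ) ℤ.+ w) (weight-tabulate n (f ∘ suc)) ⟩
    (ℤ.+ k ℤ.- 1ℤ) ℤ.+ (ℤ.+ s ℤ.- ℤ.+ n)           ≡⟨ interchange (ℤ.+ k) -1ℤ (ℤ.+ s) (ℤ.- ℤ.+ n) ⟩
    ℤ.+ (k ℕ.+ s) ℤ.+ (-1ℤ ℤ.- ℤ.+ n)              ≡⟨ cong (λ w → ℤ.+ (k ℕ.+ s) ℤ.+ w) (ℤₚ.neg-distrib-+ 1ℤ (ℤ.+ n)) ⟨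
    ℤ.+ (k ℕ.+ s) ℤ.- ℤ.+ suc n                    ∎
    where
    open ≡.≡-Reasoning
    open CommutativeSemigroupProperties ℤₚ.+-commutativeSemigroup using (interchange)
    k s : ℕ
    k = proj₂ (f zero)
    s = ℕ∑.sum (λ i → proj₂ (f (suc i)))

  sum-1 : ∀ n → ℕ∑.sum {n} (λ _ → 1) ≡ n
  sum-1 zero    = refl
  sum-1 (suc n) = cong suc (sum-1 n)

  sum-fertility : ∀ (G : Graph C) → ℕ∑.sum (Graph.fertility G) ≡ ℕ∑.sum (Graph.outdegree G)
  sum-fertility G = ℕ∑.∑-comm (λ v u → indicator (Graph.edge G u v))

  weight-tree : (τ : Tree C) → weight (fertilities (Tree.graph τ)) ≡ -1ℤ
  weight-tree τ = begin
    weight (fertilities graph)                  ≡⟨ weight-tabulate size _ ⟩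
    ℤ.+ ℕ∑.sum fertility ℤ.- ℤ.+ size           ≡⟨ cong₂ (λ k n → ℤ.+ k ℤ.- ℤ.+ n) (sum-fertility graph) (≡.sym edges) ⟩
    ℤ.+ e ℤ.- (ℤ.+ e ℤ.+ 1ℤ)                    ≡⟨ cong (λ w → ℤ.+ e ℤ.+ w) (ℤₚ.neg-distrib-+ (ℤ.+ e) 1ℤ) ⟩
    ℤ.+ e ℤ.+ (ℤ.- ℤ.+ e ℤ.+ -1ℤ)               ≡⟨ ℤₚ.+-assoc (ℤ.+ e) (ℤ.- ℤ.+ e) -1ℤ ⟨
    (ℤ.+ e ℤ.- ℤ.+ e) ℤ.+ -1ℤ                   ≡⟨ cong (λ w → w ℤ.+ -1ℤ) (ℤₚ.+-inverseʳ (ℤ.+ e)) ⟩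
    -1ℤ                                         ∎
    where
    open ≡.≡-Reasoning
    open Tree τ
    e : ℕ
    e = ℕ∑.sum outdegree
    one : ∀ v → outdegree v ℕ.+ indicator (does (v ≟ root)) ≡ 1
    one v with v ≟ root
    ... | yes refl = cong (λ k → k ℕ.+ 1) root-out
    ... | no v≢r   = ≡.trans (ℕₚ.+-identityʳ _) (nonroot-out v v≢r)
    edges : e ℕ.+ 1 ≡ size
    edges = ≡.trans (cong (λ k → e ℕ.+ k) (≡.sym (count-≟ root)))
           (≡.trans (≡.sym (ℕ∑.∑-distrib-+ outdegree _))
           (≡.trans (ℕ∑.sum-cong-≗ one) (sum-1 size)))

  weight-aroma : (a : Aroma C) → weight (fertilities (Aroma.graph a)) ≡ 0ℤ
  weight-aroma a = begin
    weight (fertilities graph)        ≡⟨ weight-tabulate size _ ⟩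
    ℤ.+ ℕ∑.sum fertility ℤ.- ℤ.+ size ≡⟨ cong (λ k → ℤ.+ k ℤ.- ℤ.+ size) (sum-fertility graph) ⟩
    ℤ.+ ℕ∑.sum outdegree ℤ.- ℤ.+ size ≡⟨ cong (λ k → ℤ.+ k ℤ.- ℤ.+ size) (≡.trans (ℕ∑.sum-cong-≗ out) (sum-1 size)) ⟩
    ℤ.+ size ℤ.- ℤ.+ size             ≡⟨ ℤₚ.+-inverseʳ (ℤ.+ size) ⟩
    0ℤ                                ∎
    where
    open ≡.≡-Reasoning
    open Aroma a

  fertilities-nonempty : (G : Graph C) → NonZero (Graph.size G) → fertilities G ≢ []
  fertilities-nonempty record { size = suc _ } _ ()

  tree-nonempty : (τ : Tree C) → NonZero (Tree.size τ)
  tree-nonempty record { graph = record { size = suc _ } } = _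
  tree-nonempty record { graph = record { size = zero } ; root = () }

-- Quotients are setoids: the free objects are terms modulo the congruence
-- generated by the module (algebra) axioms and the defining relations.

module OverField {c ℓ : Level} (𝕂 : Field c ℓ) where

  private
    module K = Field 𝕂

  L : Level
  L = c ⊔ ℓ

  Mod : Set (lsuc L)
  Mod = Module K.commutativeRing L L

  ∣_∣ : Mod → Set L
  ∣ V ∣ = Module.Carrierᴹ V

  module _ {a r : Level} {M : Set a} (_≈_ : M → M → Set r)
           (_+_ : M → M → M) (0m : M) (_·_ : K.Carrier → M → M) where

    -- The module axioms that imply the others when -x is (-1)·x.
    record ModuleLaws : Set (L ⊔ a ⊔ r) where
      field
        isEquivalence : IsEquivalence _≈_
        +-cong        : ∀ {x x′ y y′} → x ≈ x′ → y ≈ y′ → (x + y) ≈ (x′ + y′)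
        +-assoc       : ∀ x y z → ((x + y) + z) ≈ (x + (y + z))
        +-comm        : ∀ x y → (x + y) ≈ (y + x)
        +-identityˡ   : ∀ x → (0m + x) ≈ x
        ·-cong        : ∀ {k k′ x x′} → k K.≈ k′ → x ≈ x′ → (k · x) ≈ (k′ · x′)
        ·-distribˡ    : ∀ k x y → (k · (x + y)) ≈ ((k · x) + (k · y))
        ·-distribʳ    : ∀ x k l → ((k K.+ l) · x) ≈ ((k · x) + (l · x))
        ·-assoc       : ∀ k l x → ((k K.* l) · x) ≈ (k · (l · x))
        ·-identityˡ   : ∀ x → (K.1# · x) ≈ x
        ·-zeroˡ       : ∀ x → (K.0# · x) ≈ 0m

    neg : M → M
    neg x = (K.- K.1#) · x

    abstract
      mkIsModule : ModuleLaws → IsModule K.commutativeRing _≈_ _+_ 0m neg _·_ (λ x k → k · x)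
      mkIsModule laws = IsModuleFromLeft.isModule {commutativeRing = K.commutativeRing} record
        { isLeftModule = record
          { isLeftSemimodule = record
            { +ᴹ-isCommutativeMonoid = record
              { isMonoid = record
                { isSemigroup = record
                  { isMagma = record { isEquivalence = isEquivalence ; ∙-cong = +-cong }
                  ; assoc = +-assoc
                  }
                ; identity = +-identityˡ
                           , λ x → E.trans (+-comm x 0m) (+-identityˡ x)
                }
              ; comm = +-comm
              }
            ; isPreleftSemimodule = record
              { *ₗ-cong = ·-cong
              ; *ₗ-zeroˡ = ·-zeroˡ
              ; *ₗ-distribʳ = ·-distribʳ
              ; *ₗ-identityˡ = ·-identityˡ
              ; *ₗ-assoc = ·-assoc
              ; *ₗ-zeroʳ = λ k → E.trans (·-cong K.refl (E.sym (·-zeroˡ 0m)))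
                                (E.trans (E.sym (·-assoc k K.0# 0m))
                                (E.trans (·-cong (K.zeroʳ k) E.refl) (·-zeroˡ 0m)))
              ; *ₗ-distribˡ = ·-distribˡ
              }
            }
          ; -ᴹ‿cong = ·-cong K.refl
          ; -ᴹ‿inverse = inverseˡ′ , λ x → E.trans (+-comm x (neg x)) (inverseˡ′ x)
          }
        }
        where
        open ModuleLaws laws
        module E = IsEquivalence isEquivalence
        inverseˡ′ : ∀ x → (neg x + x) ≈ 0m
        inverseˡ′ x = E.trans (+-cong E.refl (E.sym (·-identityˡ x)))
                    (E.trans (E.sym (·-distribʳ x _ _))
                    (E.trans (·-cong (K.-‿inverseˡ K.1#) E.refl) (·-zeroˡ x)))

    mkModule : IsModule K.commutativeRing _≈_ _+_ 0m neg _·_ (λ x k → k · x) → Module K.commutativeRing a r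
    mkModule isModule = record
      { Carrierᴹ = M ; _≈ᴹ_ = _≈_ ; _+ᴹ_ = _+_ ; _*ₗ_ = _·_
      ; _*ᵣ_ = λ x k → k · x ; 0ᴹ = 0m ; -ᴹ_ = neg ; isModule = isModule
      }

  module _ (V W : Mod) where
    private
      module V = Module V
      module W = Module W

    IsLinear : (∣ V ∣ → ∣ W ∣) → Set L
    IsLinear = ModuleMorphism.ModuleMorphisms.IsModuleHomomorphism V.rawModule W.rawModule

    record LinearLaws (f : ∣ V ∣ → ∣ W ∣) : Set L where
      field
        f-cong : ∀ {x y} → x V.≈ᴹ y → f x W.≈ᴹ f y
        f-+    : ∀ x y → f (x V.+ᴹ y) W.≈ᴹ f x W.+ᴹ f y
        f-·    : ∀ k x → f (k V.*ₗ x) W.≈ᴹ k W.*ₗ f x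

    infix 4 _⊸_

    record _⊸_ : Set L where
      constructor mk⊸
      infixl 9 _$_
      field
        _$_      : ∣ V ∣ → ∣ W ∣
        isLinear : IsLinear _$_
      open ModuleMorphism.ModuleMorphisms.IsModuleHomomorphism isLinear public
        using (⟦⟧-cong; +ᴹ-homo; *ₗ-homo; 0ᴹ-homo)

    abstract
      mkIsLinear : ∀ {f} → LinearLaws f → IsLinear f
      mkIsLinear {f} laws = record
        { isBimoduleHomomorphism = record
          { +ᴹ-isGroupHomomorphism = record
            { isMonoidHomomorphism = record
              { isMagmaHomomorphism = record
                { isRelHomomorphism = record { cong = f-cong }
                ; homo = f-+
                }
              ; ε-homo = f-0
              }
            ; ⁻¹-homo = λ x → inverseʳ-unique (f x) (f (V.-ᴹ x))
                (W.≈ᴹ-trans (W.≈ᴹ-sym (f-+ x (V.-ᴹ x)))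
                (W.≈ᴹ-trans (f-cong (V.-ᴹ‿inverseʳ x)) f-0))
            }
          ; *ₗ-homo = f-·
          ; *ᵣ-homo = λ k x → W.≈ᴹ-trans (f-cong (V.≈ᴹ-sym (V.*ₗ-*ᵣ-coincident k x)))
                             (W.≈ᴹ-trans (f-· k x) (W.*ₗ-*ᵣ-coincident k (f x)))
          }
        }
        where
        open LinearLaws laws
        open AbelianGroupProperties W.+ᴹ-abelianGroup using (inverseʳ-unique)
        f-0 : f V.0ᴹ W.≈ᴹ W.0ᴹ
        f-0 = W.≈ᴹ-trans (f-cong (V.≈ᴹ-sym (V.*ₗ-zeroˡ V.0ᴹ)))
             (W.≈ᴹ-trans (f-· K.0# V.0ᴹ) (W.*ₗ-zeroˡ (f V.0ᴹ)))

  open _⊸_ public using (_$_; isLinear)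

  interchangeᴹ : (V : Mod) → ∀ w x y z →
                 Module._≈ᴹ_ V (Module._+ᴹ_ V (Module._+ᴹ_ V w x) (Module._+ᴹ_ V y z))
                               (Module._+ᴹ_ V (Module._+ᴹ_ V w y) (Module._+ᴹ_ V x z))
  interchangeᴹ V = CommutativeSemigroupProperties.interchange
    (CommutativeMonoid.commutativeSemigroup (Module.+ᴹ-commutativeMonoid V))

  module _ {V W : Mod} where
    private
      module W = Module W

    infix  4 _≈ₗ_
    infixl 6 _+ₗ_
    infixr 7 _·ₗ_

    _≈ₗ_ : V ⊸ W → V ⊸ W → Set L
    f ≈ₗ g = ∀ x → (f $ x) W.≈ᴹ (g $ x)

    abstract
      +ₗ-isLinear : (f g : V ⊸ W) → IsLinear V W (λ x → (f $ x) W.+ᴹ (g $ x))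
      +ₗ-isLinear f g = mkIsLinear V W record
        { f-cong = λ p → W.+ᴹ-cong (f.⟦⟧-cong p) (g.⟦⟧-cong p)
        ; f-+    = λ x y → W.≈ᴹ-trans (W.+ᴹ-cong (f.+ᴹ-homo x y) (g.+ᴹ-homo x y)) (interchangeᴹ W _ _ _ _)
        ; f-·    = λ k x → W.≈ᴹ-trans (W.+ᴹ-cong (f.*ₗ-homo k x) (g.*ₗ-homo k x))
                                      (W.≈ᴹ-sym (W.*ₗ-distribˡ k _ _))
        }
        where
        module f = _⊸_ f
        module g = _⊸_ g

      0ₗ-isLinear : IsLinear V W (λ _ → W.0ᴹ)
      0ₗ-isLinear = mkIsLinear V W record
        { f-cong = λ _ → W.≈ᴹ-refl
        ; f-+    = λ _ _ → W.≈ᴹ-sym (W.+ᴹ-identityˡ _)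
        ; f-·    = λ k _ → W.≈ᴹ-sym (W.*ₗ-zeroʳ k)
        }

      ·ₗ-isLinear : (k : K.Carrier) (f : V ⊸ W) → IsLinear V W (λ x → k W.*ₗ (f $ x))
      ·ₗ-isLinear k f = mkIsLinear V W record
        { f-cong = λ p → W.*ₗ-congˡ (f.⟦⟧-cong p)
        ; f-+    = λ x y → W.≈ᴹ-trans (W.*ₗ-congˡ (f.+ᴹ-homo x y)) (W.*ₗ-distribˡ k _ _)
        ; f-·    = λ l x → W.≈ᴹ-trans (W.*ₗ-congˡ (f.*ₗ-homo l x))
                          (W.≈ᴹ-trans (W.≈ᴹ-sym (W.*ₗ-assoc k l _))
                          (W.≈ᴹ-trans (W.*ₗ-congʳ (K.*-comm k l)) (W.*ₗ-assoc l k _)))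
        }
        where module f = _⊸_ f

    _+ₗ_ : V ⊸ W → V ⊸ W → V ⊸ W
    f +ₗ g = mk⊸ (λ x → (f $ x) W.+ᴹ (g $ x)) (+ₗ-isLinear f g)

    0ₗ : V ⊸ W
    0ₗ = mk⊸ (λ _ → W.0ᴹ) 0ₗ-isLinear

    _·ₗ_ : K.Carrier → V ⊸ W → V ⊸ W
    k ·ₗ f = mk⊸ (λ x → k W.*ₗ (f $ x)) (·ₗ-isLinear k f)

    abstract
      Hom-isModule : IsModule K.commutativeRing _≈ₗ_ _+ₗ_ 0ₗ (neg _≈ₗ_ _+ₗ_ 0ₗ _·ₗ_) _·ₗ_ (λ f k → k ·ₗ f)
      Hom-isModule = mkIsModule _≈ₗ_ _+ₗ_ 0ₗ _·ₗ_ record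
        { isEquivalence = record { refl  = λ _ → W.≈ᴹ-refl
                                 ; sym   = λ p x → W.≈ᴹ-sym (p x)
                                 ; trans = λ p q x → W.≈ᴹ-trans (p x) (q x) }
        ; +-cong      = λ p q x → W.+ᴹ-cong (p x) (q x)
        ; +-assoc     = λ f g h x → W.+ᴹ-assoc (f $ x) (g $ x) (h $ x)
        ; +-comm      = λ f g x → W.+ᴹ-comm (f $ x) (g $ x)
        ; +-identityˡ = λ f x → W.+ᴹ-identityˡ (f $ x)
        ; ·-cong      = λ p q x → W.*ₗ-cong p (q x)
        ; ·-distribˡ  = λ k f g x → W.*ₗ-distribˡ k (f $ x) (g $ x)
        ; ·-distribʳ  = λ f k l x → W.*ₗ-distribʳ (f $ x) k l
        ; ·-assoc     = λ k l f x → W.*ₗ-assoc k l (f $ x)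
        ; ·-identityˡ = λ f x → W.*ₗ-identityˡ (f $ x)
        ; ·-zeroˡ     = λ f x → W.*ₗ-zeroˡ (f $ x)
        }

  Hom : Mod → Mod → Mod
  Hom V W = mkModule {M = V ⊸ W} _≈ₗ_ _+ₗ_ 0ₗ _·ₗ_ Hom-isModule

  End : Mod → Mod
  End V = Hom V V

  infixr 9 _∘ₗ_

  abstract
    ∘ₗ-isLinear : {U V W : Mod} (g : V ⊸ W) (f : U ⊸ V) → IsLinear U W (λ x → g $ (f $ x))
    ∘ₗ-isLinear {U} {V} {W} g f = mkIsLinear U W record
      { f-cong = λ p → g.⟦⟧-cong (f.⟦⟧-cong p)
      ; f-+    = λ x y → W.≈ᴹ-trans (g.⟦⟧-cong (f.+ᴹ-homo x y)) (g.+ᴹ-homo _ _)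
      ; f-·    = λ k x → W.≈ᴹ-trans (g.⟦⟧-cong (f.*ₗ-homo k x)) (g.*ₗ-homo k _)
      }
      where
      module W = Module W
      module f = _⊸_ f
      module g = _⊸_ g

    id-isLinear : (V : Mod) → IsLinear V V (λ x → x)
    id-isLinear V = mkIsLinear V V record
      { f-cong = λ p → p ; f-+ = λ _ _ → Module.≈ᴹ-refl V ; f-· = λ _ _ → Module.≈ᴹ-refl V }

  _∘ₗ_ : {U V W : Mod} → V ⊸ W → U ⊸ V → U ⊸ W
  g ∘ₗ f = mk⊸ (λ x → g $ (f $ x)) (∘ₗ-isLinear g f)

  idₗ : (V : Mod) → V ⊸ V
  idₗ V = mk⊸ (λ x → x) (id-isLinear V)

  module _ (U V W : Mod) where
    private
      module U = Module U
      module V = Module V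
      module W = Module W

    record IsBilinear (f : ∣ U ∣ → ∣ V ∣ → ∣ W ∣) : Set L where
      field
        f-cong : ∀ {u u′ v v′} → u U.≈ᴹ u′ → v V.≈ᴹ v′ → f u v W.≈ᴹ f u′ v′
        f-+ˡ   : ∀ u u′ v → f (u U.+ᴹ u′) v W.≈ᴹ f u v W.+ᴹ f u′ v
        f-·ˡ   : ∀ k u v → f (k U.*ₗ u) v W.≈ᴹ k W.*ₗ f u v
        f-+ʳ   : ∀ u v v′ → f u (v V.+ᴹ v′) W.≈ᴹ f u v W.+ᴹ f u v′
        f-·ʳ   : ∀ k u v → f u (k V.*ₗ v) W.≈ᴹ k W.*ₗ f u v

    module _ {f : ∣ U ∣ → ∣ V ∣ → ∣ W ∣} (isBilinear : IsBilinear f) where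
      open IsBilinear isBilinear

      abstract
        bilinear-isLinearʳ : ∀ u → IsLinear V W (f u)
        bilinear-isLinearʳ u = mkIsLinear V W record
          { f-cong = f-cong U.≈ᴹ-refl ; f-+ = f-+ʳ u ; f-· = λ k → f-·ʳ k u }

        bilinear-isLinearˡ : IsLinear U (Hom V W) (λ u → mk⊸ (f u) (bilinear-isLinearʳ u))
        bilinear-isLinearˡ = mkIsLinear U (Hom V W) record
          { f-cong = λ p v → f-cong p V.≈ᴹ-refl ; f-+ = f-+ˡ ; f-· = f-·ˡ }

      bilinear : U ⊸ Hom V W
      bilinear = mk⊸ (λ u → mk⊸ (f u) (bilinear-isLinearʳ u)) bilinear-isLinearˡ

  sumᴹ : (V : Mod) {n : ℕ} → (Fin n → ∣ V ∣) → ∣ V ∣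
  sumᴹ V = Summation.sum (Module.+ᴹ-commutativeMonoid V)

  -- Terms over G modulo Congruence R form the module generated by G subject
  -- to the relations R.

  data Term {g : Level} (G : Set g) : Set (L ⊔ g) where
    gen  : G → Term G
    0ₜ   : Term G
    _+ₜ_ : Term G → Term G → Term G
    _·ₜ_ : K.Carrier → Term G → Term G

  data Congruence {g r : Level} {G : Set g} (R : Term G → Term G → Set r) :
                  Term G → Term G → Set (L ⊔ g ⊔ r) where
    rel         : ∀ {s t} → R s t → Congruence R s t
    ≈refl       : ∀ {s} → Congruence R s s
    ≈sym        : ∀ {s t} → Congruence R s t → Congruence R t s
    ≈trans      : ∀ {s t u} → Congruence R s t → Congruence R t u → Congruence R s u
    +-cong      : ∀ {s s′ t t′} → Congruence R s s′ → Congruence R t t′ → Congruence R (s +ₜ t) (s′ +ₜ t′)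
    +-assoc     : ∀ s t u → Congruence R ((s +ₜ t) +ₜ u) (s +ₜ (t +ₜ u))
    +-comm      : ∀ s t → Congruence R (s +ₜ t) (t +ₜ s)
    +-identityˡ : ∀ t → Congruence R (0ₜ +ₜ t) t
    ·-cong      : ∀ {k k′ t t′} → k K.≈ k′ → Congruence R t t′ → Congruence R (k ·ₜ t) (k′ ·ₜ t′)
    ·-distribˡ  : ∀ k s t → Congruence R (k ·ₜ (s +ₜ t)) ((k ·ₜ s) +ₜ (k ·ₜ t))
    ·-distribʳ  : ∀ t k l → Congruence R ((k K.+ l) ·ₜ t) ((k ·ₜ t) +ₜ (l ·ₜ t))
    ·-assoc     : ∀ k l t → Congruence R ((k K.* l) ·ₜ t) (k ·ₜ (l ·ₜ t))
    ·-identityˡ : ∀ t → Congruence R (K.1# ·ₜ t) t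
    ·-zeroˡ     : ∀ t → Congruence R (K.0# ·ₜ t) 0ₜ

  module _ {g : Level} {G : Set g} (W : Mod) where
    private
      module W = Module W

    eval : (G → ∣ W ∣) → Term G → ∣ W ∣
    eval f (gen x)  = f x
    eval f 0ₜ       = W.0ᴹ
    eval f (s +ₜ t) = eval f s W.+ᴹ eval f t
    eval f (k ·ₜ t) = k W.*ₗ eval f t

    eval-cong : {r : Level} {R : Term G → Term G → Set r} (f : G → ∣ W ∣) →
                (∀ {s t} → R s t → eval f s W.≈ᴹ eval f t) →
                ∀ {s t} → Congruence R s t → eval f s W.≈ᴹ eval f t
    eval-cong f resp (rel p)            = resp p
    eval-cong f resp ≈refl              = W.≈ᴹ-refl
    eval-cong f resp (≈sym p)           = W.≈ᴹ-sym (eval-cong f resp p)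
    eval-cong f resp (≈trans p q)       = W.≈ᴹ-trans (eval-cong f resp p) (eval-cong f resp q)
    eval-cong f resp (+-cong p q)       = W.+ᴹ-cong (eval-cong f resp p) (eval-cong f resp q)
    eval-cong f resp (+-assoc s t u)    = W.+ᴹ-assoc (eval f s) (eval f t) (eval f u)
    eval-cong f resp (+-comm s t)       = W.+ᴹ-comm (eval f s) (eval f t)
    eval-cong f resp (+-identityˡ t)    = W.+ᴹ-identityˡ (eval f t)
    eval-cong f resp (·-cong p q)       = W.*ₗ-cong p (eval-cong f resp q)
    eval-cong f resp (·-distribˡ k s t) = W.*ₗ-distribˡ k (eval f s) (eval f t)
    eval-cong f resp (·-distribʳ t k l) = W.*ₗ-distribʳ (eval f t) k l
    eval-cong f resp (·-assoc k l t)    = W.*ₗ-assoc k l (eval f t)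
    eval-cong f resp (·-identityˡ t)    = W.*ₗ-identityˡ (eval f t)
    eval-cong f resp (·-zeroˡ t)        = W.*ₗ-zeroˡ (eval f t)

  module _ {g r : Level} {G : Set g} (R : Term G → Term G → Set r) where

    abstract
      presented-isModule : IsModule K.commutativeRing (Congruence R) _+ₜ_ 0ₜ
                                    (neg (Congruence R) _+ₜ_ 0ₜ _·ₜ_) _·ₜ_ (λ t k → k ·ₜ t)
      presented-isModule = mkIsModule (Congruence R) _+ₜ_ 0ₜ _·ₜ_ record
        { isEquivalence = record { refl = ≈refl ; sym = ≈sym ; trans = ≈trans }
        ; +-cong = +-cong ; +-assoc = +-assoc ; +-comm = +-comm ; +-identityˡ = +-identityˡ
        ; ·-cong = ·-cong ; ·-distribˡ = ·-distribˡ ; ·-distribʳ = ·-distribʳ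
        ; ·-assoc = ·-assoc ; ·-identityˡ = ·-identityˡ ; ·-zeroˡ = ·-zeroˡ
        }

    presented : Module K.commutativeRing (L ⊔ g) (L ⊔ g ⊔ r)
    presented = mkModule (Congruence R) _+ₜ_ 0ₜ _·ₜ_ presented-isModule

  module _ (B : Setoid 0ℓ 0ℓ) where
    private
      module B = Setoid B

    data SpanRel : Term B.Carrier → Term B.Carrier → Set where
      gen-cong : ∀ {b b′} → b B.≈ b′ → SpanRel (gen b) (gen b′)

    Span : Mod
    Span = presented SpanRel

  module _ {B : Setoid 0ℓ 0ℓ} {W : Mod} where
    private
      module B = Setoid B
      module W = Module W

    module _ (f : B.Carrier → ∣ W ∣) (f-cong : ∀ {b b′} → b B.≈ b′ → f b W.≈ᴹ f b′) where

      abstract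
        extend-isLinear : IsLinear (Span B) W (eval W f)
        extend-isLinear = mkIsLinear (Span B) W record
          { f-cong = eval-cong W {R = SpanRel B} f λ { (gen-cong p) → f-cong p }
          ; f-+ = λ _ _ → W.≈ᴹ-refl ; f-· = λ _ _ → W.≈ᴹ-refl }

      extend : Span B ⊸ W
      extend = mk⊸ (eval W f) extend-isLinear

    Span-ext : (g h : Span B ⊸ W) → (∀ b → (g $ gen b) W.≈ᴹ (h $ gen b)) → g ≈ₗ h
    Span-ext g h p (gen b)  = p b
    Span-ext g h p 0ₜ       = W.≈ᴹ-trans (_⊸_.0ᴹ-homo g) (W.≈ᴹ-sym (_⊸_.0ᴹ-homo h))
    Span-ext g h p (s +ₜ t) = W.≈ᴹ-trans (_⊸_.+ᴹ-homo g s t)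
      (W.≈ᴹ-trans (W.+ᴹ-cong (Span-ext g h p s) (Span-ext g h p t)) (W.≈ᴹ-sym (_⊸_.+ᴹ-homo h s t)))
    Span-ext g h p (k ·ₜ t) = W.≈ᴹ-trans (_⊸_.*ₗ-homo g k t)
      (W.≈ᴹ-trans (W.*ₗ-congˡ (Span-ext g h p t)) (W.≈ᴹ-sym (_⊸_.*ₗ-homo h k t)))

  module _ {B B′ : Setoid 0ℓ 0ℓ} {W : Mod} where
    private
      module B  = Setoid B
      module B′ = Setoid B′
      module W = Module W

    module _ (f : B.Carrier → B′.Carrier → ∣ W ∣)
             (f-cong : ∀ {b b′ d d′} → b B.≈ b′ → d B′.≈ d′ → f b d W.≈ᴹ f b′ d′) where
      private
        extendʳ : B.Carrier → Span B′ ⊸ W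
        extendʳ b = extend {B = B′} (f b) (f-cong B.refl)

      abstract
        extendʳ-cong : ∀ {b b′} → b B.≈ b′ → extendʳ b ≈ₗ extendʳ b′
        extendʳ-cong {b} {b′} p = Span-ext (extendʳ b) (extendʳ b′) (λ d → f-cong p B′.refl)

      extend₂ : Span B ⊸ Hom (Span B′) W
      extend₂ = extend {B = B} {W = Hom (Span B′) W} extendʳ extendʳ-cong

  module _ (V W : Mod) where
    private
      module V = Module V
      module W = Module W

    data ⊗Rel : Term (∣ V ∣ × ∣ W ∣) → Term (∣ V ∣ × ∣ W ∣) → Set L where
      ⊗-cong : ∀ {v v′ w w′} → v V.≈ᴹ v′ → w W.≈ᴹ w′ → ⊗Rel (gen (v , w)) (gen (v′ , w′))
      ⊗-+ˡ   : ∀ v v′ w → ⊗Rel (gen (v V.+ᴹ v′ , w)) (gen (v , w) +ₜ gen (v′ , w))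
      ⊗-·ˡ   : ∀ k v w → ⊗Rel (gen (k V.*ₗ v , w)) (k ·ₜ gen (v , w))
      ⊗-+ʳ   : ∀ v w w′ → ⊗Rel (gen (v , w W.+ᴹ w′)) (gen (v , w) +ₜ gen (v , w′))
      ⊗-·ʳ   : ∀ k v w → ⊗Rel (gen (v , k W.*ₗ w)) (k ·ₜ gen (v , w))

    infixl 7 _⊗_

    _⊗_ : Mod
    _⊗_ = presented ⊗Rel

  module _ {V W U : Mod} where
    private
      module U = Module U

    module _ (f : V ⊸ Hom W U) where
      private
        module f = _⊸_ f

        f′ : ∣ V ∣ × ∣ W ∣ → ∣ U ∣
        f′ (v , w) = f $ v $ w

      abstract
        ⊗-elim-isLinear : IsLinear (V ⊗ W) U (eval U f′)
        ⊗-elim-isLinear = mkIsLinear (V ⊗ W) U record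
          { f-cong = eval-cong U f′ λ
            { (⊗-cong {v} {v′} {w} p q) → U.≈ᴹ-trans (f.⟦⟧-cong p w) (_⊸_.⟦⟧-cong (f $ v′) q)
            ; (⊗-+ˡ v v′ w) → f.+ᴹ-homo v v′ w
            ; (⊗-·ˡ k v w)  → f.*ₗ-homo k v w
            ; (⊗-+ʳ v w w′) → _⊸_.+ᴹ-homo (f $ v) w w′
            ; (⊗-·ʳ k v w)  → _⊸_.*ₗ-homo (f $ v) k w
            }
          ; f-+ = λ _ _ → U.≈ᴹ-refl ; f-· = λ _ _ → U.≈ᴹ-refl }

      ⊗-elim : V ⊗ W ⊸ U
      ⊗-elim = mk⊸ (eval U f′) ⊗-elim-isLinear

    ⊗-ext : (g h : V ⊗ W ⊸ U) → (∀ v w → (g $ gen (v , w)) U.≈ᴹ (h $ gen (v , w))) → g ≈ₗ h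
    ⊗-ext g h p (gen (v , w)) = p v w
    ⊗-ext g h p 0ₜ       = U.≈ᴹ-trans (_⊸_.0ᴹ-homo g) (U.≈ᴹ-sym (_⊸_.0ᴹ-homo h))
    ⊗-ext g h p (s +ₜ t) = U.≈ᴹ-trans (_⊸_.+ᴹ-homo g s t)
      (U.≈ᴹ-trans (U.+ᴹ-cong (⊗-ext g h p s) (⊗-ext g h p t)) (U.≈ᴹ-sym (_⊸_.+ᴹ-homo h s t)))
    ⊗-ext g h p (k ·ₜ t) = U.≈ᴹ-trans (_⊸_.*ₗ-homo g k t)
      (U.≈ᴹ-trans (U.*ₗ-congˡ (⊗-ext g h p t)) (U.≈ᴹ-sym (_⊸_.*ₗ-homo h k t)))

  module _ {V V′ W W′ : Mod} (f : V ⊸ V′) (g : W ⊸ W′) where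
    private
      module f = _⊸_ f
      module g = _⊸_ g

    abstract
      ⊗-map-isBilinear : IsBilinear V W (V′ ⊗ W′) (λ v w → gen (f $ v , g $ w))
      ⊗-map-isBilinear = record
        { f-cong = λ p q → rel (⊗-cong (f.⟦⟧-cong p) (g.⟦⟧-cong q))
        ; f-+ˡ   = λ v v′ w → ≈trans (rel (⊗-cong (f.+ᴹ-homo v v′) (Module.≈ᴹ-refl W′))) (rel (⊗-+ˡ _ _ _))
        ; f-·ˡ   = λ k v w → ≈trans (rel (⊗-cong (f.*ₗ-homo k v) (Module.≈ᴹ-refl W′))) (rel (⊗-·ˡ _ _ _))
        ; f-+ʳ   = λ v w w′ → ≈trans (rel (⊗-cong (Module.≈ᴹ-refl V′) (g.+ᴹ-homo w w′))) (rel (⊗-+ʳ _ _ _))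
        ; f-·ʳ   = λ k v w → ≈trans (rel (⊗-cong (Module.≈ᴹ-refl V′) (g.*ₗ-homo k w))) (rel (⊗-·ʳ _ _ _))
        }

    ⊗-map : V ⊗ W ⊸ V′ ⊗ W′
    ⊗-map = ⊗-elim (bilinear V W (V′ ⊗ W′) ⊗-map-isBilinear)

  module _ {V W U : Mod} (α : V ⊸ End U) (β : W ⊸ End U) where
    private
      module U = Module U
      module α = _⊸_ α
      module β = _⊸_ β

    abstract
      compose-isBilinear : IsBilinear V W (End U) (λ v w → (α $ v) ∘ₗ (β $ w))
      compose-isBilinear = record
        { f-cong = λ {v} {v′} {w} p q u →
            U.≈ᴹ-trans (α.⟦⟧-cong p (β $ w $ u)) (_⊸_.⟦⟧-cong (α $ v′) (q′ q u))
        ; f-+ˡ   = λ v v′ w u → α.+ᴹ-homo v v′ (β $ w $ u)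
        ; f-·ˡ   = λ k v w u → α.*ₗ-homo k v (β $ w $ u)
        ; f-+ʳ   = λ v w w′ u → U.≈ᴹ-trans (_⊸_.⟦⟧-cong (α $ v) (β.+ᴹ-homo w w′ u)) (_⊸_.+ᴹ-homo (α $ v) _ _)
        ; f-·ʳ   = λ k v w u → U.≈ᴹ-trans (_⊸_.⟦⟧-cong (α $ v) (β.*ₗ-homo k w u)) (_⊸_.*ₗ-homo (α $ v) k _)
        }
        where
        q′ : ∀ {w w′} → Module._≈ᴹ_ W w w′ → (β $ w) ≈ₗ (β $ w′)
        q′ = β.⟦⟧-cong

    -- v ⊗ w ↦ α v ∘ β w
    compose : V ⊗ W ⊸ End U
    compose = ⊗-elim (bilinear V W (End U) compose-isBilinear)

  infixl 6 _+ₛ_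
  infixl 7 _*ₛ_
  infixr 7 _·ₛ_
  infix  4 _≈ₛ_

  -- Sym V modulo _≈ₛ_ is the commutative algebra freely generated by the
  -- module V, that is, its symmetric algebra.
  data Sym (V : Mod) : Set L where
    ι    : ∣ V ∣ → Sym V
    0ₛ   : Sym V
    1ₛ   : Sym V
    _+ₛ_ : Sym V → Sym V → Sym V
    _*ₛ_ : Sym V → Sym V → Sym V
    _·ₛ_ : K.Carrier → Sym V → Sym V

  data _≈ₛ_ {V : Mod} : Sym V → Sym V → Set L where
    ≈refl       : ∀ {s} → s ≈ₛ s
    ≈sym        : ∀ {s t} → s ≈ₛ t → t ≈ₛ s
    ≈trans      : ∀ {s t u} → s ≈ₛ t → t ≈ₛ u → s ≈ₛ u
    +-cong      : ∀ {s s′ t t′} → s ≈ₛ s′ → t ≈ₛ t′ → s +ₛ t ≈ₛ s′ +ₛ t′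
    +-assoc     : ∀ s t u → (s +ₛ t) +ₛ u ≈ₛ s +ₛ (t +ₛ u)
    +-comm      : ∀ s t → s +ₛ t ≈ₛ t +ₛ s
    +-identityˡ : ∀ t → 0ₛ +ₛ t ≈ₛ t
    ·-cong      : ∀ {k k′ t t′} → k K.≈ k′ → t ≈ₛ t′ → k ·ₛ t ≈ₛ k′ ·ₛ t′
    ·-distribˡ  : ∀ k s t → k ·ₛ (s +ₛ t) ≈ₛ k ·ₛ s +ₛ k ·ₛ t
    ·-distribʳ  : ∀ t k l → (k K.+ l) ·ₛ t ≈ₛ k ·ₛ t +ₛ l ·ₛ t
    ·-assoc     : ∀ k l t → (k K.* l) ·ₛ t ≈ₛ k ·ₛ (l ·ₛ t)
    ·-identityˡ : ∀ t → K.1# ·ₛ t ≈ₛ t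
    ·-zeroˡ     : ∀ t → K.0# ·ₛ t ≈ₛ 0ₛ
    *-cong      : ∀ {s s′ t t′} → s ≈ₛ s′ → t ≈ₛ t′ → s *ₛ t ≈ₛ s′ *ₛ t′
    *-assoc     : ∀ s t u → (s *ₛ t) *ₛ u ≈ₛ s *ₛ (t *ₛ u)
    *-comm      : ∀ s t → s *ₛ t ≈ₛ t *ₛ s
    *-identityˡ : ∀ t → 1ₛ *ₛ t ≈ₛ t
    *-distribʳ  : ∀ u s t → (s +ₛ t) *ₛ u ≈ₛ s *ₛ u +ₛ t *ₛ u
    ·-*-assoc   : ∀ k s t → (k ·ₛ s) *ₛ t ≈ₛ k ·ₛ (s *ₛ t)
    ι-cong      : ∀ {v w} → Module._≈ᴹ_ V v w → ι v ≈ₛ ι w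
    ι-+         : ∀ v w → ι (Module._+ᴹ_ V v w) ≈ₛ ι v +ₛ ι w
    ι-·         : ∀ k v → ι (Module._*ₗ_ V k v) ≈ₛ k ·ₛ ι v

  module _ (V : Mod) where

    abstract
      S-isModule : IsModule K.commutativeRing (_≈ₛ_ {V}) _+ₛ_ 0ₛ (neg _≈ₛ_ _+ₛ_ 0ₛ _·ₛ_) _·ₛ_ (λ t k → k ·ₛ t)
      S-isModule = mkIsModule _≈ₛ_ _+ₛ_ 0ₛ _·ₛ_ record
        { isEquivalence = record { refl = ≈refl ; sym = ≈sym ; trans = ≈trans }
        ; +-cong = +-cong ; +-assoc = +-assoc ; +-comm = +-comm ; +-identityˡ = +-identityˡ
        ; ·-cong = ·-cong ; ·-distribˡ = ·-distribˡ ; ·-distribʳ = ·-distribʳ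
        ; ·-assoc = ·-assoc ; ·-identityˡ = ·-identityˡ ; ·-zeroˡ = ·-zeroˡ
        }

    S : Mod
    S = mkModule (_≈ₛ_ {V}) _+ₛ_ 0ₛ _·ₛ_ S-isModule

  module _ {V : Mod} where
    private
      module S = Module (S V)

    *-distribˡ : (u s t : Sym V) → u *ₛ (s +ₛ t) ≈ₛ u *ₛ s +ₛ u *ₛ t
    *-distribˡ u s t = ≈trans (*-comm u _)
      (≈trans (*-distribʳ u s t) (+-cong (*-comm s u) (*-comm t u)))

    *-·-comm : ∀ k (s t : Sym V) → s *ₛ (k ·ₛ t) ≈ₛ k ·ₛ (s *ₛ t)
    *-·-comm k s t = ≈trans (*-comm s _) (≈trans (·-*-assoc k t s) (·-cong K.refl (*-comm t s)))

    *-zeroˡ : (t : Sym V) → 0ₛ *ₛ t ≈ₛ 0ₛ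
    *-zeroˡ t = ≈trans (*-cong (≈sym (·-zeroˡ 0ₛ)) ≈refl)
               (≈trans (·-*-assoc K.0# 0ₛ t) (·-zeroˡ (0ₛ *ₛ t)))

    abstract
      S-isCommutativeRing : IsCommutativeRing (_≈ₛ_ {V}) _+ₛ_ _*ₛ_ S.-ᴹ_ 0ₛ 1ₛ
      S-isCommutativeRing = record
        { isRing = record
          { +-isAbelianGroup = S.+ᴹ-isAbelianGroup
          ; *-cong = *-cong
          ; *-assoc = *-assoc
          ; *-identity = *-identityˡ , λ t → ≈trans (*-comm t 1ₛ) (*-identityˡ t)
          ; distrib = *-distribˡ , *-distribʳ
          }
        ; *-comm = *-comm
        }

  S-ring : Mod → CommutativeRing L L
  S-ring V = record
    { Carrier = Sym V ; _≈_ = _≈ₛ_ ; _+_ = _+ₛ_ ; _*_ = _*ₛ_ ; -_ = Module.-ᴹ_ (S V)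
    ; 0# = 0ₛ ; 1# = 1ₛ ; isCommutativeRing = S-isCommutativeRing }

  module _ (V : Mod) where

    abstract
      mul-isBilinear : IsBilinear (S V) (S V) (S V) _*ₛ_
      mul-isBilinear = record
        { f-cong = *-cong ; f-+ˡ = λ s s′ t → *-distribʳ t s s′ ; f-·ˡ = ·-*-assoc
        ; f-+ʳ = *-distribˡ ; f-·ʳ = *-·-comm }

    mul : S V ⊸ End (S V)
    mul = bilinear (S V) (S V) (S V) mul-isBilinear

  module _ {V W : Mod} (f : V ⊸ W) where
    private
      module f = _⊸_ f

    S-fun : Sym V → Sym W
    S-fun (ι v)    = ι (f $ v)
    S-fun 0ₛ       = 0ₛ
    S-fun 1ₛ       = 1ₛ
    S-fun (s +ₛ t) = S-fun s +ₛ S-fun t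
    S-fun (s *ₛ t) = S-fun s *ₛ S-fun t
    S-fun (k ·ₛ t) = k ·ₛ S-fun t

    S-fun-cong : ∀ {s t} → s ≈ₛ t → S-fun s ≈ₛ S-fun t
    S-fun-cong ≈refl              = ≈refl
    S-fun-cong (≈sym p)           = ≈sym (S-fun-cong p)
    S-fun-cong (≈trans p q)       = ≈trans (S-fun-cong p) (S-fun-cong q)
    S-fun-cong (+-cong p q)       = +-cong (S-fun-cong p) (S-fun-cong q)
    S-fun-cong (+-assoc s t u)    = +-assoc _ _ _
    S-fun-cong (+-comm s t)       = +-comm _ _
    S-fun-cong (+-identityˡ t)    = +-identityˡ _
    S-fun-cong (·-cong p q)       = ·-cong p (S-fun-cong q)
    S-fun-cong (·-distribˡ k s t) = ·-distribˡ _ _ _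
    S-fun-cong (·-distribʳ t k l) = ·-distribʳ _ _ _
    S-fun-cong (·-assoc k l t)    = ·-assoc _ _ _
    S-fun-cong (·-identityˡ t)    = ·-identityˡ _
    S-fun-cong (·-zeroˡ t)        = ·-zeroˡ _
    S-fun-cong (*-cong p q)       = *-cong (S-fun-cong p) (S-fun-cong q)
    S-fun-cong (*-assoc s t u)    = *-assoc _ _ _
    S-fun-cong (*-comm s t)       = *-comm _ _
    S-fun-cong (*-identityˡ t)    = *-identityˡ _
    S-fun-cong (*-distribʳ u s t) = *-distribʳ _ _ _
    S-fun-cong (·-*-assoc k s t)  = ·-*-assoc _ _ _
    S-fun-cong (ι-cong p)         = ι-cong (f.⟦⟧-cong p)
    S-fun-cong (ι-+ v w)          = ≈trans (ι-cong (f.+ᴹ-homo v w)) (ι-+ _ _)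
    S-fun-cong (ι-· k v)          = ≈trans (ι-cong (f.*ₗ-homo k v)) (ι-· _ _)

    abstract
      S-map-isLinear : IsLinear (S V) (S W) S-fun
      S-map-isLinear = mkIsLinear (S V) (S W) record
        { f-cong = S-fun-cong ; f-+ = λ _ _ → ≈refl ; f-· = λ _ _ → ≈refl }

    S-map : S V ⊸ S W
    S-map = mk⊸ S-fun S-map-isLinear

  -- der d is the unique derivation of S V extending d; on a product of
  -- generators it is the sum over the factors of applying d to one of them.

  module _ {V : Mod} where
    open SetoidReasoning (Module.≈ᴹ-setoid (S V))

    module _ (d : V ⊸ V) where
      private
        module d = _⊸_ d

      der-fun : Sym V → Sym V
      der-fun (ι v)    = ι (d $ v)
      der-fun 0ₛ       = 0ₛ
      der-fun 1ₛ       = 0ₛ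
      der-fun (s +ₛ t) = der-fun s +ₛ der-fun t
      der-fun (s *ₛ t) = der-fun s *ₛ t +ₛ s *ₛ der-fun t
      der-fun (k ·ₛ t) = k ·ₛ der-fun t

      der-cong : ∀ {s t} → s ≈ₛ t → der-fun s ≈ₛ der-fun t
      der-cong ≈refl             = ≈refl
      der-cong (≈sym p)          = ≈sym (der-cong p)
      der-cong (≈trans p q)      = ≈trans (der-cong p) (der-cong q)
      der-cong (+-cong p q)      = +-cong (der-cong p) (der-cong q)
      der-cong (+-assoc s t u)   = +-assoc _ _ _
      der-cong (+-comm s t)      = +-comm _ _
      der-cong (+-identityˡ t)   = +-identityˡ _
      der-cong (·-cong p q)      = ·-cong p (der-cong q)
      der-cong (·-distribˡ k s t) = ·-distribˡ _ _ _
      der-cong (·-distribʳ t k l) = ·-distribʳ _ _ _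
      der-cong (·-assoc k l t)   = ·-assoc _ _ _
      der-cong (·-identityˡ t)   = ·-identityˡ _
      der-cong (·-zeroˡ t)       = ·-zeroˡ _
      der-cong (*-cong p q)      = +-cong (*-cong (der-cong p) q) (*-cong p (der-cong q))
      der-cong (*-assoc s t u)   = begin
        (der-fun s *ₛ t +ₛ s *ₛ der-fun t) *ₛ u +ₛ (s *ₛ t) *ₛ der-fun u
          ≈⟨ +-cong (*-distribʳ u _ _) (*-assoc s t _) ⟩
        ((der-fun s *ₛ t) *ₛ u +ₛ (s *ₛ der-fun t) *ₛ u) +ₛ s *ₛ (t *ₛ der-fun u)
          ≈⟨ +-cong (+-cong (*-assoc _ t u) (*-assoc s _ u)) ≈refl ⟩
        (der-fun s *ₛ (t *ₛ u) +ₛ s *ₛ (der-fun t *ₛ u)) +ₛ s *ₛ (t *ₛ der-fun u)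
          ≈⟨ +-assoc _ _ _ ⟩
        der-fun s *ₛ (t *ₛ u) +ₛ (s *ₛ (der-fun t *ₛ u) +ₛ s *ₛ (t *ₛ der-fun u))
          ≈⟨ +-cong ≈refl (*-distribˡ s _ _) ⟨
        der-fun s *ₛ (t *ₛ u) +ₛ s *ₛ (der-fun t *ₛ u +ₛ t *ₛ der-fun u) ∎
      der-cong (*-comm s t)      = begin
        der-fun s *ₛ t +ₛ s *ₛ der-fun t ≈⟨ +-cong (*-comm _ t) (*-comm s _) ⟩
        t *ₛ der-fun s +ₛ der-fun t *ₛ s ≈⟨ +-comm _ _ ⟩
        der-fun t *ₛ s +ₛ t *ₛ der-fun s ∎
      der-cong (*-identityˡ t)   = begin
        0ₛ *ₛ t +ₛ 1ₛ *ₛ der-fun t ≈⟨ +-cong (*-zeroˡ t) (*-identityˡ _) ⟩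
        0ₛ +ₛ der-fun t            ≈⟨ +-identityˡ _ ⟩
        der-fun t                  ∎
      der-cong (*-distribʳ u s t) = begin
        (der-fun s +ₛ der-fun t) *ₛ u +ₛ (s +ₛ t) *ₛ der-fun u
          ≈⟨ +-cong (*-distribʳ u _ _) (*-distribʳ _ s t) ⟩
        (der-fun s *ₛ u +ₛ der-fun t *ₛ u) +ₛ (s *ₛ der-fun u +ₛ t *ₛ der-fun u)
          ≈⟨ interchangeᴹ (S V) _ _ _ _ ⟩
        (der-fun s *ₛ u +ₛ s *ₛ der-fun u) +ₛ (der-fun t *ₛ u +ₛ t *ₛ der-fun u) ∎
      der-cong (·-*-assoc k s t) = begin
        (k ·ₛ der-fun s) *ₛ t +ₛ (k ·ₛ s) *ₛ der-fun t ≈⟨ +-cong (·-*-assoc k _ t) (·-*-assoc k s _) ⟩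
        k ·ₛ (der-fun s *ₛ t) +ₛ k ·ₛ (s *ₛ der-fun t) ≈⟨ ·-distribˡ k _ _ ⟨
        k ·ₛ (der-fun s *ₛ t +ₛ s *ₛ der-fun t)        ∎
      der-cong (ι-cong p)        = ι-cong (d.⟦⟧-cong p)
      der-cong (ι-+ v w)         = ≈trans (ι-cong (d.+ᴹ-homo v w)) (ι-+ _ _)
      der-cong (ι-· k v)         = ≈trans (ι-cong (d.*ₗ-homo k v)) (ι-· _ _)

      abstract
        der-isLinear : IsLinear (S V) (S V) der-fun
        der-isLinear = mkIsLinear (S V) (S V) record
          { f-cong = der-cong ; f-+ = λ _ _ → ≈refl ; f-· = λ _ _ → ≈refl }

    der-ext : (d e : V ⊸ V) → d ≈ₗ e → ∀ s → der-fun d s ≈ₛ der-fun e s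
    der-ext d e p (ι v)    = ι-cong (p v)
    der-ext d e p 0ₛ       = ≈refl
    der-ext d e p 1ₛ       = ≈refl
    der-ext d e p (s +ₛ t) = +-cong (der-ext d e p s) (der-ext d e p t)
    der-ext d e p (s *ₛ t) = +-cong (*-cong (der-ext d e p s) ≈refl) (*-cong ≈refl (der-ext d e p t))
    der-ext d e p (k ·ₛ t) = ·-cong K.refl (der-ext d e p t)

    der-+ : ∀ d e s → der-fun (d +ₗ e) s ≈ₛ der-fun d s +ₛ der-fun e s
    der-+ d e (ι v)    = ι-+ _ _
    der-+ d e 0ₛ       = ≈sym (+-identityˡ 0ₛ)
    der-+ d e 1ₛ       = ≈sym (+-identityˡ 0ₛ)
    der-+ d e (s +ₛ t) = ≈trans (+-cong (der-+ d e s) (der-+ d e t)) (interchangeᴹ (S V) _ _ _ _)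
    der-+ d e (s *ₛ t) = ≈trans
      (+-cong (≈trans (*-cong (der-+ d e s) ≈refl) (*-distribʳ t _ _))
              (≈trans (*-cong ≈refl (der-+ d e t)) (*-distribˡ s _ _)))
      (interchangeᴹ (S V) _ _ _ _)
    der-+ d e (k ·ₛ t) = ≈trans (·-cong K.refl (der-+ d e t)) (·-distribˡ k _ _)

    der-· : ∀ k d s → der-fun (k ·ₗ d) s ≈ₛ k ·ₛ der-fun d s
    der-· k d (ι v)    = ι-· k _
    der-· k d 0ₛ       = ≈sym (Module.*ₗ-zeroʳ (S V) k)
    der-· k d 1ₛ       = ≈sym (Module.*ₗ-zeroʳ (S V) k)
    der-· k d (s +ₛ t) = ≈trans (+-cong (der-· k d s) (der-· k d t)) (≈sym (·-distribˡ k _ _))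
    der-· k d (s *ₛ t) = ≈trans
      (+-cong (≈trans (*-cong (der-· k d s) ≈refl) (·-*-assoc k _ t))
              (≈trans (*-cong ≈refl (der-· k d t)) (*-·-comm k s _)))
      (≈sym (·-distribˡ k _ _))
    der-· k d (l ·ₛ t) = ≈trans (·-cong K.refl (der-· k d t))
      (≈trans (≈sym (·-assoc l k _)) (≈trans (·-cong (K.*-comm l k) ≈refl) (·-assoc k l _)))

    abstract
      der-isLinear₂ : IsLinear (End V) (End (S V)) (λ d → mk⊸ (der-fun d) (der-isLinear d))
      der-isLinear₂ = mkIsLinear (End V) (End (S V)) record
        { f-cong = λ {d} {e} → der-ext d e ; f-+ = der-+ ; f-· = der-· }

    der : End V ⊸ End (S V)
    der = mk⊸ (λ d → mk⊸ (der-fun d) (der-isLinear d)) der-isLinear₂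

  -- The product and anchor on S V ⊗ W induced by bilinear products
  -- W × V → V and W × W → W; see anchor-pure and product-pure below.

  module Rinehart (V W : Mod) (actV : W ⊸ End V) (actW : W ⊸ End W) where
    private
      module W = Module W

      X : Mod
      X = S V ⊗ W

      scale₁ : Sym V → X ⊸ X
      scale₁ a = ⊗-map (mul V $ a) (idₗ W)

    D : W ⊸ End (S V)
    D = der ∘ₗ actV

    abstract
      scale-isLinear : IsLinear (S V) (End X) scale₁
      scale-isLinear = mkIsLinear (S V) (End X) record
        { f-cong = λ {a} {a′} p → ⊗-ext (scale₁ a) (scale₁ a′)
            λ b w → rel (⊗-cong (*-cong p ≈refl) W.≈ᴹ-refl)
        ; f-+ = λ a a′ → ⊗-ext (scale₁ (a +ₛ a′)) (scale₁ a +ₗ scale₁ a′)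
            λ b w → ≈trans (rel (⊗-cong (*-distribʳ b a a′) W.≈ᴹ-refl)) (rel (⊗-+ˡ _ _ _))
        ; f-· = λ k a → ⊗-ext (scale₁ (k ·ₛ a)) (k ·ₗ scale₁ a)
            λ b w → ≈trans (rel (⊗-cong (·-*-assoc k a b) W.≈ᴹ-refl)) (rel (⊗-·ˡ _ _ _))
        }

    scale : S V ⊸ End X
    scale = mk⊸ scale₁ scale-isLinear

    private
      ∇₁ : ∣ W ∣ → X ⊸ X
      ∇₁ w = ⊗-map (D $ w) (idₗ W) +ₗ ⊗-map (idₗ (S V)) (actW $ w)

    abstract
      ∇-isLinear : IsLinear W (End X) ∇₁
      ∇-isLinear = mkIsLinear W (End X) record
        { f-cong = λ {w} {w′} p → ⊗-ext (∇₁ w) (∇₁ w′) λ a u →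
            +-cong (rel (⊗-cong (_⊸_.⟦⟧-cong D p a) W.≈ᴹ-refl))
                   (rel (⊗-cong ≈refl (_⊸_.⟦⟧-cong actW p u)))
        ; f-+ = λ w w′ → ⊗-ext (∇₁ (w W.+ᴹ w′)) (∇₁ w +ₗ ∇₁ w′) λ a u →
            ≈trans (+-cong (≈trans (rel (⊗-cong (_⊸_.+ᴹ-homo D w w′ a) W.≈ᴹ-refl)) (rel (⊗-+ˡ _ _ _)))
                           (≈trans (rel (⊗-cong ≈refl (_⊸_.+ᴹ-homo actW w w′ u))) (rel (⊗-+ʳ _ _ _))))
                   (interchangeᴹ X _ _ _ _)
        ; f-· = λ k w → ⊗-ext (∇₁ (k W.*ₗ w)) (k ·ₗ ∇₁ w) λ a u →
            ≈trans (+-cong (≈trans (rel (⊗-cong (_⊸_.*ₗ-homo D k w a) W.≈ᴹ-refl)) (rel (⊗-·ˡ _ _ _)))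
                           (≈trans (rel (⊗-cong ≈refl (_⊸_.*ₗ-homo actW k w u))) (rel (⊗-·ʳ _ _ _))))
                   (≈sym (·-distribˡ k _ _))
        }

    ∇ : W ⊸ End X
    ∇ = mk⊸ ∇₁ ∇-isLinear

    anchor : X ⊸ End (S V)
    anchor = compose (mul V) D

    product : X ⊸ End X
    product = compose scale ∇

    anchor-pure : ∀ a w b → anchor $ gen (a , w) $ b ≡ a *ₛ (D $ w $ b)
    anchor-pure _ _ _ = refl

    product-pure : ∀ a₁ w₁ a₂ w₂ → product $ gen (a₁ , w₁) $ gen (a₂ , w₂) ≡
      gen (a₁ *ₛ (D $ w₁ $ a₂) , w₂) +ₜ gen (a₁ *ₛ a₂ , actW $ w₁ $ w₂)
    product-pure _ _ _ _ = refl

  module Fertility (C : Set) where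

    T A₀ : Mod
    T  = Span (TreeSetoid C)
    A₀ = Span (AromaSetoid C)

    graftT₁ : Tree C → Tree C → ∣ T ∣
    graftT₁ τ σ = sumᴹ T (λ v → gen (graftTree τ σ v))

    graftA₁ : Tree C → Aroma C → ∣ A₀ ∣
    graftA₁ τ a = sumᴹ A₀ (λ v → gen (graftAroma τ a v))

    abstract
      graftT₁-cong : ∀ {τ τ′ σ σ′} → Tree.graph τ ≅ Tree.graph τ′ → Tree.graph σ ≅ Tree.graph σ′ →
                     Module._≈ᴹ_ T (graftT₁ τ σ) (graftT₁ τ′ σ′)
      graftT₁-cong {τ} {τ′} {σ} {σ′} p q = ≈sym (≈trans
        (∑.sum-permute (λ v → gen (graftTree τ′ σ′ v)) (_≅_.bij q))
        (∑.sum-cong-≋ {n = Tree.size σ} {λ v → gen (graftTree τ′ σ′ (_≅_.bij q ⟨$⟩ʳ v))} {λ v → gen (graftTree τ σ v)}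
          λ v → ≈sym (rel (gen-cong (graft-cong p q (root-pres τ τ′ p) v)))))
        where module ∑ = Summation (Module.+ᴹ-commutativeMonoid T)

      graftA₁-cong : ∀ {τ τ′ a a′} → Tree.graph τ ≅ Tree.graph τ′ → Aroma.graph a ≅ Aroma.graph a′ →
                     Module._≈ᴹ_ A₀ (graftA₁ τ a) (graftA₁ τ′ a′)
      graftA₁-cong {τ} {τ′} {a} {a′} p q = ≈sym (≈trans
        (∑.sum-permute (λ v → gen (graftAroma τ′ a′ v)) (_≅_.bij q))
        (∑.sum-cong-≋ {n = Aroma.size a} {λ v → gen (graftAroma τ′ a′ (_≅_.bij q ⟨$⟩ʳ v))} {λ v → gen (graftAroma τ a v)}
          λ v → ≈sym (rel (gen-cong (graft-cong p q (root-pres τ τ′ p) v)))))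
        where module ∑ = Summation (Module.+ᴹ-commutativeMonoid A₀)

    graftT : T ⊸ End T
    graftT = extend₂ {TreeSetoid C} {TreeSetoid C} {T} graftT₁ (λ {τ} {τ′} {σ} {σ′} → graftT₁-cong {τ} {τ′} {σ} {σ′})

    graftA : T ⊸ End A₀
    graftA = extend₂ {TreeSetoid C} {AromaSetoid C} {A₀} graftA₁ (λ {τ} {τ′} {a} {a′} → graftA₁-cong {τ} {τ′} {a} {a′})

    𝒜 𝒜T : Mod
    𝒜  = S A₀
    𝒜T = 𝒜 ⊗ T

    module Trees = Rinehart A₀ T graftA graftT

    Vars : Mod
    Vars = Span (≡.setoid (Var C))

    -- The polynomial algebra on the variables x^a_j, as the symmetric algebra
    -- of the vector space they span.
    N : Mod
    N = S Vars

    x^_ : List (Var C) → Sym Vars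
    x^_ = foldr (λ v p → ι (gen v) *ₛ p) 1ₛ

    ∂ : N ⊸ N
    ∂ = der $ extend {≡.setoid (Var C)} {Vars} (λ v → gen (raise v)) (λ { refl → ≈refl })

    -- The subspace of N spanned by the monomials satisfying P; resp makes it
    -- a subspace of the quotient.
    data SpanOf (P : List (Var C) → Set) : Sym Vars → Set L where
      mono : ∀ ks → P ks → SpanOf P (x^ ks)
      zero : SpanOf P 0ₛ
      add  : ∀ {p q} → SpanOf P p → SpanOf P q → SpanOf P (p +ₛ q)
      mult : ∀ {p} k → SpanOf P p → SpanOf P (k ·ₛ p)
      resp : ∀ {p q} → p ≈ₛ q → SpanOf P p → SpanOf P q

    Weight : ℤ → List (Var C) → Set
    Weight n ks = weight ks ≡ n

    x^-++ : ∀ ks ls → x^ (ks ++ ls) ≈ₛ x^ ks *ₛ x^ ls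
    x^-++ []       ls = ≈sym (*-identityˡ _)
    x^-++ (k ∷ ks) ls = ≈trans (*-cong ≈refl (x^-++ ks ls)) (≈sym (*-assoc _ _ _))

    weaken : ∀ {P Q : List (Var C) → Set} → (∀ ks → P ks → Q ks) → ∀ {p} → SpanOf P p → SpanOf Q p
    weaken f (mono ks h) = mono ks (f ks h)
    weaken f zero        = zero
    weaken f (add p q)   = add (weaken f p) (weaken f q)
    weaken f (mult k p)  = mult k (weaken f p)
    weaken f (resp e p)  = resp e (weaken f p)

    times : ∀ {P Q R : List (Var C) → Set} → (∀ ks ls → P ks → Q ls → R (ks ++ ls)) →
            ∀ {p q} → SpanOf P p → SpanOf Q q → SpanOf R (p *ₛ q)
    times f (mono ks h) (mono ls h′) = resp (x^-++ ks ls) (mono (ks ++ ls) (f ks ls h h′))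
    times f p@(mono _ _) zero        = resp (≈sym (≈trans (*-comm _ _) (*-zeroˡ _))) zero
    times f p@(mono _ _) (add q q′)  = resp (≈sym (*-distribˡ _ _ _)) (add (times f p q) (times f p q′))
    times f p@(mono _ _) (mult k q)  = resp (≈sym (*-·-comm k _ _)) (mult k (times f p q))
    times f p@(mono _ _) (resp e q)  = resp (*-cong ≈refl e) (times f p q)
    times f zero       q = resp (≈sym (*-zeroˡ _)) zero
    times f (add p p′) q = resp (≈sym (*-distribʳ _ _ _)) (add (times f p q) (times f p′ q))
    times f (mult k p) q = resp (≈sym (·-*-assoc k _ _)) (mult k (times f p q))
    times f (resp e p) q = resp (*-cong e ≈refl) (times f p q)

    ∂-mono : ∀ ks → SpanOf (Weight (weight ks ℤ.+ 1ℤ)) (∂ $ (x^ ks))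
    ∂-mono []       = zero
    ∂-mono (k ∷ ks) = add
      (mono (raise k ∷ ks) (≡.trans (cong (λ w → w ℤ.+ weight ks) (varWeight-raise k))
        (xy∙z≈xz∙y (varWeight k) 1ℤ (weight ks))))
      (resp (*-cong (≈trans (*-comm _ _) (*-identityˡ _)) ≈refl)
        (times (λ { _ ls refl h → ≡.trans (weight-++ (k ∷ []) ls)
                  (≡.trans (cong₂ ℤ._+_ (ℤₚ.+-identityʳ (varWeight k)) h)
                           (≡.sym (ℤₚ.+-assoc (varWeight k) (weight ks) 1ℤ))) })
               (mono {λ ls → ls ≡ k ∷ []} (k ∷ []) refl) (∂-mono ks)))
      where open CommutativeSemigroupProperties ℤₚ.+-commutativeSemigroup using (xy∙z≈xz∙y)

    ∂-weight : ∀ {n p} → SpanOf (Weight n) p → SpanOf (Weight (n ℤ.+ 1ℤ)) (∂ $ p)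
    ∂-weight (mono ks refl) = ∂-mono ks
    ∂-weight zero           = zero
    ∂-weight (add p q)      = add (∂-weight p) (∂-weight q)
    ∂-weight (mult k p)     = mult k (∂-weight p)
    ∂-weight (resp e p)     = resp (_⊸_.⟦⟧-cong ∂ e) (∂-weight p)

    -- The condition ks ≢ [] excludes the constant monomial; it is automatic
    -- unless n is 0.
    Basis : ℤ → List (Var C) → Set
    Basis n ks = ks ≢ [] × weight ks ≡ n

    module _ (n : ℤ) where
      private
        Carrier : Set L
        Carrier = Σ (Sym Vars) (SpanOf (Basis n))

        _≈′_ : Carrier → Carrier → Set L
        p ≈′ q = proj₁ p ≈ₛ proj₁ q

        _+′_ : Carrier → Carrier → Carrier
        (p , hp) +′ (q , hq) = p +ₛ q , add hp hq

        0′ : Carrier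
        0′ = 0ₛ , zero

        _·′_ : K.Carrier → Carrier → Carrier
        k ·′ (p , hp) = k ·ₛ p , mult k hp

      abstract
        M-isModule : IsModule K.commutativeRing _≈′_ _+′_ 0′ (neg _≈′_ _+′_ 0′ _·′_) _·′_ (λ p k → k ·′ p)
        M-isModule = mkIsModule _≈′_ _+′_ 0′ _·′_ record
          { isEquivalence = record { refl = ≈refl ; sym = ≈sym ; trans = ≈trans }
          ; +-cong = +-cong ; +-assoc = λ _ _ _ → +-assoc _ _ _ ; +-comm = λ _ _ → +-comm _ _
          ; +-identityˡ = λ _ → +-identityˡ _ ; ·-cong = ·-cong
          ; ·-distribˡ = λ _ _ _ → ·-distribˡ _ _ _ ; ·-distribʳ = λ _ _ _ → ·-distribʳ _ _ _
          ; ·-assoc = λ _ _ _ → ·-assoc _ _ _ ; ·-identityˡ = λ _ → ·-identityˡ _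
          ; ·-zeroˡ = λ _ → ·-zeroˡ _ }

      M : Mod
      M = mkModule _≈′_ _+′_ 0′ _·′_ M-isModule

    M₀ M₋₁ : Mod
    M₀  = M 0ℤ
    M₋₁ = M -1ℤ

    abstract
      insert-closed : ∀ n {p q} → SpanOf (Basis -1ℤ) p → SpanOf (Basis n) q → SpanOf (Basis n) (p *ₛ (∂ $ q))
      insert-closed n hp hq = times basis hp (∂-weight (weaken (λ _ → proj₂) hq))
        where
        basis : ∀ ks ls → Basis -1ℤ ks → weight ls ≡ n ℤ.+ 1ℤ → Basis n (ks ++ ls)
        basis []       ls (ks≢[] , _) _ = contradiction refl ks≢[]
        basis (k ∷ ks) ls (_ , wk)    wl = (λ ()) , (begin
          weight (k ∷ ks ++ ls)          ≡⟨ weight-++ (k ∷ ks) ls ⟩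
          weight (k ∷ ks) ℤ.+ weight ls  ≡⟨ cong₂ ℤ._+_ wk wl ⟩
          -1ℤ ℤ.+ (n ℤ.+ 1ℤ)             ≡⟨ ℤₚ.+-comm -1ℤ (n ℤ.+ 1ℤ) ⟩
          (n ℤ.+ 1ℤ) ℤ.+ -1ℤ             ≡⟨ ℤₚ.+-assoc n 1ℤ -1ℤ ⟩
          n ℤ.+ 0ℤ                       ≡⟨ ℤₚ.+-identityʳ n ⟩
          n                              ∎)
          where open ≡.≡-Reasoning

    insert : ∀ n → ∣ M₋₁ ∣ → ∣ M n ∣ → ∣ M n ∣
    insert n (p , hp) (q , hq) = p *ₛ (∂ $ q) , insert-closed n hp hq

    abstract
      insert-isBilinear : ∀ n → IsBilinear M₋₁ (M n) (M n) (insert n)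
      insert-isBilinear n = record
        { f-cong = λ e e′ → *-cong e (_⊸_.⟦⟧-cong ∂ e′)
        ; f-+ˡ   = λ (p , _) (p′ , _) (q , _) → *-distribʳ (∂ $ q) p p′
        ; f-·ˡ   = λ k (p , _) (q , _) → ·-*-assoc k p (∂ $ q)
        ; f-+ʳ   = λ (p , _) (q , _) (q′ , _) → *-distribˡ p (∂ $ q) (∂ $ q′)
        ; f-·ʳ   = λ k (p , _) (q , _) → *-·-comm k p (∂ $ q)
        }

    insertion : ∀ n → M₋₁ ⊸ End (M n)
    insertion n = bilinear M₋₁ (M n) (M n) (insert-isBilinear n)

    SM₀ 𝒜M₋₁ : Mod
    SM₀  = S M₀
    𝒜M₋₁ = SM₀ ⊗ M₋₁

    module Indices = Rinehart M₀ M₋₁ (insertion 0ℤ) (insertion -1ℤ)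

    x^-tabulate : ∀ n (f : Fin n → Var C) →
                  x^ (tabulate f) ≡ Summation.sum (CommutativeRing.*-commutativeMonoid (S-ring Vars)) (λ i → ι (gen (f i)))
    x^-tabulate zero    f = refl
    x^-tabulate (suc n) f = cong (ι (gen (f zero)) *ₛ_) (x^-tabulate n (f ∘ suc))

    fertilities-cong : ∀ {G H : Graph C} → G ≅ H → x^ (fertilities G) ≈ₛ x^ (fertilities H)
    fertilities-cong {G} {H} p = begin
      x^ (fertilities G)             ≡⟨ x^-tabulate (Graph.size G) (λ v → Graph.deco G v , Graph.fertility G v) ⟩
      ∏.sum (var G)                  ≡⟨ ∏.sum-cong-≗ (λ v → cong (λ k → ι (gen k))
                                          (≡.sym (cong₂ _,_ (_≅_.deco-pres p v) (_≅_.fertility-pres p v)))) ⟩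
      ∏.sum (λ v → var H (_≅_.bij p ⟨$⟩ʳ v)) ≈⟨ ∏.sum-permute (var H) (_≅_.bij p) ⟨
      ∏.sum (var H)                  ≡⟨ x^-tabulate (Graph.size H) (λ v → Graph.deco H v , Graph.fertility H v) ⟨
      x^ (fertilities H)             ∎
      where
      module ∏ = Summation (CommutativeRing.*-commutativeMonoid (S-ring Vars))
      open SetoidReasoning (CommutativeRing.setoid (S-ring Vars))
      var : (G : Graph C) → Fin (Graph.size G) → Sym Vars
      var G v = ι (gen (Graph.deco G v , Graph.fertility G v))

    ΦT₁ : Tree C → ∣ M₋₁ ∣
    ΦT₁ τ = x^ (fertilities (Tree.graph τ))
          , mono _ (fertilities-nonempty (Tree.graph τ) (tree-nonempty τ) , weight-tree τ)

    ΦA₁ : Aroma C → ∣ M₀ ∣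
    ΦA₁ a = x^ (fertilities (Aroma.graph a))
          , mono _ (fertilities-nonempty (Aroma.graph a) (Aroma.nonempty a) , weight-aroma a)

    ΦT : T ⊸ M₋₁
    ΦT = extend {TreeSetoid C} {M₋₁} ΦT₁ fertilities-cong

    ΦA₀ : A₀ ⊸ M₀
    ΦA₀ = extend {AromaSetoid C} {M₀} ΦA₁ fertilities-cong

    Φᴬ : 𝒜 ⊸ SM₀
    Φᴬ = S-map ΦA₀

    Φ : 𝒜T ⊸ 𝒜M₋₁
    Φ = ⊗-map Φᴬ ΦT

    infix  4 _≈_ _≈₀_
    infixl 6 _↷_ _▷_
    infixr 7 _∙_ _⊙_

    _≈_ : ∣ 𝒜M₋₁ ∣ → ∣ 𝒜M₋₁ ∣ → Set L
    _≈_ = Module._≈ᴹ_ 𝒜M₋₁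

    _≈₀_ : ∣ SM₀ ∣ → ∣ SM₀ ∣ → Set L
    _≈₀_ = Module._≈ᴹ_ SM₀

    _↷_ : ∣ 𝒜T ∣ → ∣ 𝒜T ∣ → ∣ 𝒜T ∣
    X ↷ Y = Trees.product $ X $ Y

    _▷_ : ∣ 𝒜M₋₁ ∣ → ∣ 𝒜M₋₁ ∣ → ∣ 𝒜M₋₁ ∣
    X ▷ Y = Indices.product $ X $ Y

    _∙_ : ∣ 𝒜 ∣ → ∣ 𝒜T ∣ → ∣ 𝒜T ∣
    a ∙ X = Trees.scale $ a $ X

    _⊙_ : ∣ SM₀ ∣ → ∣ 𝒜M₋₁ ∣ → ∣ 𝒜M₋₁ ∣
    y ⊙ X = Indices.scale $ y $ X

    ρ𝒜 : ∣ 𝒜T ∣ → ∣ 𝒜 ∣ → ∣ 𝒜 ∣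
    ρ𝒜 X a = Trees.anchor $ X $ a

    ρM : ∣ 𝒜M₋₁ ∣ → ∣ SM₀ ∣ → ∣ SM₀ ∣
    ρM X y = Indices.anchor $ X $ y

    𝒜-ring SM₀-ring : CommutativeRing L L
    𝒜-ring   = S-ring A₀
    SM₀-ring = S-ring M₀

{-# OPTIONS --safe #-}

-- Summing over the vertices v of x, grafting τ at v keeps the fertilities of τ
-- and raises exactly the one of v, so that Φ sends τ ↷ x to Φ(τ) ∂Φ(x) by the
-- Leibniz rule. Since anchor and product are built from grafting by the same
-- constructions on both sides, and these are natural, it is enough to know this
-- on trees and aromas.

module Submission where

open import Defs
open import Algebra.Bundles using (CommutativeRing)
open import Algebra.Morphism.Structures using (module RingMorphisms)
import Algebra.Properties.CommutativeMonoid.Sum as Summation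
open import Algebra.Module.Bundles using (Module)
open import Data.Bool.Base using (true; false; if_then_else_; _∧_)
open import Data.Bool.Properties using (∧-zeroʳ; ∧-identityʳ)
open import Data.Fin.Base using (Fin; zero; suc; splitAt)
open import Data.Fin.Properties using (_≟_)
open import Data.Integer.Base using (0ℤ; -1ℤ)
open import Data.Nat.Base as ℕ using (ℕ; zero; suc)
import Data.Nat.Properties as ℕₚ
open import Data.Product.Base using (_×_; _,_; proj₁)
open import Data.Sum.Base using (_⊎_; inj₁; inj₂; [_,_])
open import Function.Base using (_∘_)
open import Function.Bundles using (_↔_)
import Relation.Binary.Reasoning.Setoid as SetoidReasoning
open import Relation.Binary.PropositionalEquality as ≡ using (_≡_; refl; cong)
open import Relation.Nullary using (does)

module _ {C : Set} (τ : Graph C) (r : Fin (Graph.size τ)) (x : Graph C) (v : Fin (Graph.size x)) where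
  private
    module τ = Graph τ
    module x = Graph x
    module G = Graph (graftGraph τ r x v)

  -- On the `x` side the choice between `raise y` and `y` is written as a conditional in `w` and
  -- `v`, which is exactly the shape of the factors in the Leibniz expansion `∂-∏`.
  graftVar : Fin τ.size ⊎ Fin x.size → Var C
  graftVar (inj₁ u) = τ.deco u , τ.fertility u
  graftVar (inj₂ w) = if does (w ≟ v) then raise y else y
    where
    y : Var C
    y = x.deco w , x.fertility w

  private
    -- Used with `b` equal to `does (w ≟ v)`: only `r` can send a new edge to `w`, so there is one
    -- such edge or none.
    count-root : ∀ b → count (λ u → does (u ≟ r) ∧ b) ≡ indicator b
    count-root true  = ≡.trans (ℕ∑.sum-cong-≗ (λ u → cong indicator (∧-identityʳ (does (u ≟ r))))) (count-≟ r)
    count-root false = ≡.trans (ℕ∑.sum-cong-≗ (λ u → cong indicator (∧-zeroʳ (does (u ≟ r))))) (count-false τ.size)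

    indegree : Fin τ.size ⊎ Fin x.size → ℕ
    indegree s = count (λ u → graftEdge τ r x v (inj₁ u) s) ℕ.+ count (λ w → graftEdge τ r x v (inj₂ w) s)

    -- No edge leads from `x` to `τ`, so fertilities in `τ` are unchanged; the single new edge adds
    -- one to the fertility of `v` and nothing elsewhere in `x`.
    deco-indegree : ∀ s → ([ τ.deco , x.deco ] s , indegree s) ≡ graftVar s
    deco-indegree (inj₁ u) = cong (τ.deco u ,_)
      (≡.trans (cong (τ.fertility u ℕ.+_) (count-false x.size)) (ℕₚ.+-identityʳ _))
    deco-indegree (inj₂ w) = ≡.trans (cong (λ k → x.deco w , k ℕ.+ x.fertility w) (count-root (does (w ≟ v))))
                                     (raise-if (does (w ≟ v)))
      where
      raise-if : ∀ b → (x.deco w , indicator b ℕ.+ x.fertility w) ≡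
                       (if b then raise (x.deco w , x.fertility w) else (x.deco w , x.fertility w))
      raise-if true  = refl
      raise-if false = refl

  graft-var : ∀ a → (G.deco a , G.fertility a) ≡ graftVar (splitAt τ.size a)
  graft-var a = ≡.trans
    (cong (G.deco a ,_) (sum-⊎ ℕₚ.+-0-commutativeMonoid τ.size
      (λ s → indicator (graftEdge τ r x v s (splitAt τ.size a)))))
    (deco-indegree (splitAt τ.size a))

module _ {c ℓ} (𝕂 : Field c ℓ) where
  open OverField 𝕂

  module _ {V W : Mod} (f : V ⊸ W) where
    private
      module f = _⊸_ f

    sumᴹ-homo : ∀ {n} (v : Fin n → ∣ V ∣) →
                Module._≈ᴹ_ W (f $ sumᴹ V v) (sumᴹ W (λ i → f $ v i))
    sumᴹ-homo {zero}  v = f.0ᴹ-homo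
    sumᴹ-homo {suc n} v = Module.≈ᴹ-trans W (f.+ᴹ-homo _ _)
      (Module.+ᴹ-congˡ W (sumᴹ-homo (v ∘ suc)))

    -- Together with `precompose`, makes both sides of a naturality square linear in the acting
    -- element too, so that `⊗-ext` and `Span-ext` apply to that argument.
    postcompose : (U : Mod) → Hom U V ⊸ Hom U W
    postcompose U = mk⊸ (f ∘ₗ_) (mkIsLinear (Hom U V) (Hom U W) record
      { f-cong = λ p u → f.⟦⟧-cong (p u)
      ; f-+    = λ g h u → f.+ᴹ-homo (g $ u) (h $ u)
      ; f-·    = λ k g u → f.*ₗ-homo k (g $ u)
      })

    precompose : (U : Mod) → Hom W U ⊸ Hom V U
    precompose U = mk⊸ (_∘ₗ f) (mkIsLinear (Hom W U) (Hom V U) record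
      { f-cong = λ p v → p (f $ v)
      ; f-+    = λ _ _ _ → Module.≈ᴹ-refl U
      ; f-·    = λ _ _ _ → Module.≈ᴹ-refl U
      })

    -- Both sides are derivations along the algebra morphism `S-map f`, hence are determined by
    -- their values on generators, where they agree by hypothesis.
    S-map-der : (d : V ⊸ V) (e : W ⊸ W) → f ∘ₗ d ≈ₗ e ∘ₗ f →
                S-map f ∘ₗ (der $ d) ≈ₗ (der $ e) ∘ₗ S-map f
    S-map-der d e p = go
      where
      go : S-map f ∘ₗ (der $ d) ≈ₗ (der $ e) ∘ₗ S-map f
      go (ι v)    = ι-cong (p v)
      go 0ₛ       = ≈refl
      go 1ₛ       = ≈refl
      go (s +ₛ t) = +-cong (go s) (go t)
      go (s *ₛ t) = +-cong (*-cong (go s) ≈refl) (*-cong ≈refl (go t))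
      go (k ·ₛ t) = ·-cong (Field.refl 𝕂) (go t)

    S-map-isRingHomomorphism :
      RingMorphisms.IsRingHomomorphism (CommutativeRing.rawRing (S-ring V))
                                       (CommutativeRing.rawRing (S-ring W)) (S-map f $_)
    S-map-isRingHomomorphism = record
      { isSemiringHomomorphism = record
        { isNearSemiringHomomorphism = record
          { +-isMonoidHomomorphism = record
            { isMagmaHomomorphism = record
              { isRelHomomorphism = record { cong = S-fun-cong f }
              ; homo = λ _ _ → ≈refl
              }
            ; ε-homo = ≈refl
            }
          ; *-homo = λ _ _ → ≈refl
          }
        ; 1#-homo = ≈refl
        }
      ; -‿homo = λ _ → ≈refl
      }

  module _ {V W V′ W′ : Mod}
           (actV : W ⊸ End V) (actW : W ⊸ End W) (actV′ : W′ ⊸ End V′) (actW′ : W′ ⊸ End W′)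
           (f : V ⊸ V′) (g : W ⊸ W′) where
    private
      module R  = Rinehart V W actV actW
      module R′ = Rinehart V′ W′ actV′ actW′
      module V′ = Module V′
      module W′ = Module W′

      X X′ : Mod
      X  = S V ⊗ W
      X′ = S V′ ⊗ W′

      -- The general form of `Φ`, which is the case where `f` is `ΦA₀` and `g` is `ΦT`.
      F : X ⊸ X′
      F = ⊗-map (S-map f) g

    scale-natural : ∀ a → F ∘ₗ (R.scale $ a) ≈ₗ (R′.scale $ (S-map f $ a)) ∘ₗ F
    scale-natural a = ⊗-ext (F ∘ₗ (R.scale $ a)) ((R′.scale $ (S-map f $ a)) ∘ₗ F) λ _ _ → ≈refl

    module _ (f-act : ∀ w → f ∘ₗ (actV $ w) ≈ₗ (actV′ $ (g $ w)) ∘ₗ f) where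

      D-natural : ∀ w → S-map f ∘ₗ (R.D $ w) ≈ₗ (R′.D $ (g $ w)) ∘ₗ S-map f
      D-natural w = S-map-der f (actV $ w) (actV′ $ (g $ w)) (f-act w)

      -- On `a ⊗ w` the anchor is `D w` followed by multiplication by `a`; `S-map f` is
      -- multiplicative and intertwines the derivations.
      anchor-natural : ∀ x → S-map f ∘ₗ (R.anchor $ x) ≈ₗ (R′.anchor $ (F $ x)) ∘ₗ S-map f
      anchor-natural = ⊗-ext {U = Hom (S V) (S V′)}
        (postcompose (S-map f) (S V) ∘ₗ R.anchor)
        (precompose (S-map f) (S V′) ∘ₗ R′.anchor ∘ₗ F)
        λ a w b → *-cong ≈refl (D-natural w b)

      product-natural : (∀ w → g ∘ₗ (actW $ w) ≈ₗ (actW′ $ (g $ w)) ∘ₗ g) →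
                        ∀ x → F ∘ₗ (R.product $ x) ≈ₗ (R′.product $ (F $ x)) ∘ₗ F
      product-natural g-act = ⊗-ext {U = Hom X X′}
        (postcompose F X ∘ₗ R.product)
        (precompose F X′ ∘ₗ R′.product ∘ₗ F)
        λ a w → ⊗-ext (F ∘ₗ (R.product $ gen (a , w))) ((R′.product $ (F $ gen (a , w))) ∘ₗ F)
        -- The two summands of `product-pure`: in the first `w` acts on the coefficient `b`, in the
        -- second on `u`.
        λ b u → +-cong (rel (⊗-cong (*-cong ≈refl (D-natural w b)) W′.≈ᴹ-refl))
                       (rel (⊗-cong ≈refl (g-act w u)))

  module _ (C : Set) where
    open Fertility C

    private
      module ∏ = Summation (CommutativeRing.*-commutativeMonoid (S-ring Vars))

      var : (G : Graph C) → Fin (Graph.size G) → Var C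
      var G v = Graph.deco G v , Graph.fertility G v

      X : Var C → Sym Vars
      X y = ι (gen y)

    -- The Leibniz rule, by induction on the number of factors: the summand at `zero` raises the
    -- head, and the others carry the head along as a constant factor.
    ∂-∏ : ∀ n (y : Fin n → Var C) →
          ∂ $ ∏.sum (λ w → X (y w)) ≈ₛ
          sumᴹ N (λ v → ∏.sum (λ w → X (if does (w ≟ v) then raise (y w) else y w)))
    ∂-∏ zero    y = ≈refl
    ∂-∏ (suc n) y = +-cong ≈refl
      (≈trans (*-cong ≈refl (∂-∏ n (y ∘ suc))) (sumᴹ-homo (mul Vars $ X (y zero)) {n = n} _))

    fertilities-graft : ∀ (τ : Graph C) r x v →
      x^ (fertilities (graftGraph τ r x v)) ≈ₛ
      x^ (fertilities τ) *ₛ ∏.sum (λ w → X (graftVar τ r x v (inj₂ w)))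
    fertilities-graft τ r x v = begin
      x^ (fertilities G)                                     ≡⟨ x^-tabulate (Graph.size G) (var G) ⟩
      ∏.sum (λ a → X (var G a))                              ≡⟨ ∏.sum-cong-≗ (λ a → cong X (graft-var τ r x v a)) ⟩
      ∏.sum (λ a → X (graftVar τ r x v (splitAt m a)))       ≈⟨ sum-⊎ (CommutativeRing.*-commutativeMonoid (S-ring Vars)) m
                                                                  (X ∘ graftVar τ r x v) ⟩
      ∏.sum (λ u → X (var τ u)) *ₛ grafted                   ≡⟨ cong (_*ₛ grafted) (x^-tabulate m (var τ)) ⟨
      x^ (fertilities τ) *ₛ grafted                          ∎
      where
      open SetoidReasoning (CommutativeRing.setoid (S-ring Vars))
      G = graftGraph τ r x v
      m = Graph.size τ
      grafted = ∏.sum (λ w → X (graftVar τ r x v (inj₂ w)))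

    -- Stated for arbitrary graphs and in the full polynomial algebra `N`, so that trees and aromas
    -- are treated at once, without weight conditions.
    sum-fertilities-graft : ∀ (τ : Graph C) r x →
      sumᴹ N (λ v → x^ (fertilities (graftGraph τ r x v))) ≈ₛ
      x^ (fertilities τ) *ₛ (∂ $ (x^ (fertilities x)))
    sum-fertilities-graft τ r x = begin
      sumᴹ N (λ v → x^ (fertilities (graftGraph τ r x v)))    ≈⟨ ∑.sum-cong-≋ {n = n} (fertilities-graft τ r x) ⟩
      sumᴹ N (λ v → x^ (fertilities τ) *ₛ grafted v)          ≈⟨ sumᴹ-homo (mul Vars $ (x^ (fertilities τ))) grafted ⟨
      -- Each `grafted v` is by definition the Leibniz summand that raises the factor of `v`.
      x^ (fertilities τ) *ₛ sumᴹ N grafted                    ≈⟨ *-cong ≈refl (∂-∏ n (var x)) ⟨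
      x^ (fertilities τ) *ₛ (∂ $ ∏.sum (λ w → X (var x w)))   ≡⟨ cong (λ p → x^ (fertilities τ) *ₛ (∂ $ p)) (x^-tabulate n (var x)) ⟨
      x^ (fertilities τ) *ₛ (∂ $ (x^ (fertilities x)))        ∎
      where
      open SetoidReasoning (CommutativeRing.setoid (S-ring Vars))
      module ∑ = Summation (Module.+ᴹ-commutativeMonoid N)
      n = Graph.size x
      grafted : Fin n → Sym Vars
      grafted v = ∏.sum (λ w → X (graftVar τ r x v (inj₂ w)))

    -- Equality in `M n` is equality of the underlying polynomials; composing with this map moves
    -- sums taken in `T` or `A₀` directly to `N`.
    M-inclusion : ∀ n → M n ⊸ N
    M-inclusion n = mk⊸ proj₁ (mkIsLinear (M n) N record
      { f-cong = λ p → p ; f-+ = λ _ _ → ≈refl ; f-· = λ _ _ → ≈refl })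

    -- Linearity in both arguments reduces the claim to two trees, where grafting is the sum treated
    -- by `sum-fertilities-graft`.
    ΦT-graft : ∀ t → ΦT ∘ₗ (graftT $ t) ≈ₗ (insertion -1ℤ $ (ΦT $ t)) ∘ₗ ΦT
    ΦT-graft = Span-ext {W = Hom T M₋₁}
      (postcompose ΦT T ∘ₗ graftT)
      (precompose ΦT M₋₁ ∘ₗ insertion -1ℤ ∘ₗ ΦT)
      λ τ → Span-ext (ΦT ∘ₗ (graftT $ gen τ)) ((insertion -1ℤ $ (ΦT $ gen τ)) ∘ₗ ΦT)
      λ σ → ≈trans (sumᴹ-homo (M-inclusion -1ℤ ∘ₗ ΦT) (λ v → gen (graftTree τ σ v)))
                   (sum-fertilities-graft (Tree.graph τ) (Tree.root τ) (Tree.graph σ))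

    ΦA₀-graft : ∀ t → ΦA₀ ∘ₗ (graftA $ t) ≈ₗ (insertion 0ℤ $ (ΦT $ t)) ∘ₗ ΦA₀
    ΦA₀-graft = Span-ext {W = Hom A₀ M₀}
      (postcompose ΦA₀ A₀ ∘ₗ graftA)
      (precompose ΦA₀ M₀ ∘ₗ insertion 0ℤ ∘ₗ ΦT)
      λ τ → Span-ext (ΦA₀ ∘ₗ (graftA $ gen τ)) ((insertion 0ℤ $ (ΦT $ gen τ)) ∘ₗ ΦA₀)
      λ a → ≈trans (sumᴹ-homo (M-inclusion 0ℤ ∘ₗ ΦA₀) (λ v → gen (graftAroma τ a v)))
                   (sum-fertilities-graft (Tree.graph τ) (Tree.root τ) (Aroma.graph a))

theorem3p6 : ∀ {c ℓ} (𝕂 : Field c ℓ) (C : Set) (n : ℕ) (finite : C ↔ Fin n) →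
    let open OverField 𝕂
        open Fertility C
        open RingMorphisms (CommutativeRing.rawRing 𝒜-ring) (CommutativeRing.rawRing SM₀-ring)
    in (IsLinear 𝒜 SM₀ (Φᴬ $_) × IsRingHomomorphism (Φᴬ $_))
     × IsLinear 𝒜T 𝒜M₋₁ (Φ $_)
     × (∀ X Y → Φ $ (X ↷ Y) ≈ (Φ $ X) ▷ (Φ $ Y))
     × (∀ a X → Φ $ (a ∙ X) ≈ (Φᴬ $ a) ⊙ (Φ $ X))
     × (∀ X a → Φᴬ $ (ρ𝒜 X a) ≈₀ ρM (Φ $ X) (Φᴬ $ a))
theorem3p6 𝕂 C _ _ =
    (isLinear Φᴬ , S-map-isRingHomomorphism 𝕂 ΦA₀)
  , isLinear Φ
  , product-natural 𝕂 graftA graftT (insertion 0ℤ) (insertion -1ℤ) ΦA₀ ΦT (ΦA₀-graft 𝕂 C) (ΦT-graft 𝕂 C)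
  , scale-natural 𝕂 graftA graftT (insertion 0ℤ) (insertion -1ℤ) ΦA₀ ΦT
  , anchor-natural 𝕂 graftA graftT (insertion 0ℤ) (insertion -1ℤ) ΦA₀ ΦT (ΦA₀-graft 𝕂 C)
  where
  open OverField 𝕂
  open Fertility C
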